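{- Let $k\in\mathbb{N}$ and $N=pq$ where $p,q$ are odd primes with $p\neq q$. Let $m\in\mathbb{N}$ be coprime to $N$ with $\left(\frac{m}{p}\right)_{2^{k-1}}=\left(\frac{m}{q}\right)_{2^{k-1}}=1$. Let $\phi_m$ be the permutation of $\mathbb{Z}_N$ given by $x\bmod N\mapsto mx\bmod N$. Then \[ \left(\frac{m}{N}\right)_{2^k}=\begin{cases}\operatorname{sgn}\left(\phi_m|_{\mathbb{Z}_{N,2^{k-1}}}\right) & \text{if } N\equiv 1 \pmod{2^k},\\[2pt] \operatorname{sgn}\left(\phi_m|_{\mathbb{Z}_{N,2^{k-1}}^*}\right) & \text{if } N\not\equiv 1\pmod{2^k}.\end{cases} \]
   Context: For $k\in\mathbb{N}_0$, a prime $p$ and $a\in\mathbb{Z}$ with $p\nmid a$, $\left(\frac{a}{p}\right)_{2^k}=1$ if there is $x\in\mathbb{Z}$ with $x^{2^k}\equiv a \pmod p$, and $-1$ otherwise; for $n=p_1\cdots p_l$ (primes not necessarily distinct) with $\gcd(n,a)=1$, $\left(\frac{a}{n}\right)_{2^k}:=\prod_i\left(\frac{a}{p_i}\right)_{2^k}$. For $n\in\mathbb{N}$, $j\in\mathbb{N}_0$: $\mathbb{Z}_{n,2^j}:=\{r\in\mathbb{Z}_n:\exists x\in\mathbb{Z},\ x^{2^j}\equiv r\pmod n\}$ and $\mathbb{Z}_{n,2^j}^*$ is the set of units of $\mathbb{Z}_n$ that are $2^j$-th powers modulo $n$. Under the hypotheses, multiplication by $m$ maps each of these sets (for $n=N$,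 $j=k-1$) bijectively to itself, so the restrictions are permutations. -}

module Defs where

open import Data.Nat using (ℕ; zero; suc; _^_; _*_; _%_; _<?_; _≟_)
open import Data.Nat.GCD using (gcd)
open import Data.Integer using (ℤ; 1ℤ; -1ℤ) renaming (_^_ to _^ℤ_)
open import Data.List using (List; []; _∷_; upTo; filter; length)
open import Data.List.Relation.Unary.Any using (Any; any?)
open import Data.Bool using (if_then_else_)
open import Relation.Nullary using (does)
open import Relation.Nullary.Decidable using (_×-dec_)
open import Relation.Binary.PropositionalEquality using (_≡_)
open import Data.Nat using (_+_)

-- reduction modulo n (n = 0 never occurs in the theorem: all moduli are ≥ 3)
modN : ℕ → ℕ → ℕ
modN a zero    = a
modN a (suc n) = a % suc n

-- a is a 2^k-th power residue mod n: ∃ x, x^(2^k) ≡ a (mod n).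
-- It suffices to search x among the residues 0 … n-1.
isPow2kRes? : (k n a : ℕ) → _
isPow2kRes? k n a = any? (λ x → modN (x ^ (2 ^ k)) n ≟ modN a n) (upTo n)

powSym : (k p a : ℕ) → ℤ
powSym k p a = if does (isPow2kRes? k p a) then 1ℤ else -1ℤ

Zpow : (n j : ℕ) → List ℕ
Zpow n j = filter (λ r → isPow2kRes? j n r) (upTo n)

ZpowUnits : (n j : ℕ) → List ℕ
ZpowUnits n j = filter (λ r → (gcd r n ≟ 1) ×-dec isPow2kRes? j n r) (upTo n)

-- number of inversions of f on a list (list assumed strictly increasing):
-- pairs x before y (so x < y) with f y < f x
inversions : (ℕ → ℕ) → List ℕ → ℕ
inversions f []       = 0
inversions f (x ∷ xs) = length (filter (λ y → f y <? f x) xs) + inversions f xs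

-- sign of a permutation f of the finite set S ⊆ ℕ (given as ascending list):
-- (-1)^(number of inversions)
sgn : (ℕ → ℕ) → List ℕ → ℤ
sgn f S = -1ℤ ^ℤ inversions f S

phi : (N m : ℕ) → ℕ → ℕ
phi N m x = modN (m * x) N

{-# OPTIONS --safe #-}
-- For an odd prime r let A_r be the group of units mod r that are 2^(k-1)-th powers,
-- and D_r ∈ ℤ/2 the parity of multiplication by m on A_r.
--
-- D_r = 1 iff m is not a square in A_r.  Squares act evenly.  If m is not a square,
-- x ↦ m x is the composite of x ↦ 1/x and x ↦ m/x; the latter has no fixed points, so
-- |A_r| is even, so the former fixes exactly 1 and -1, and the numbers of 2-cycles of
-- the two involutions differ by one.  In particular D_r = 1 forces -1 ∈ A_r.
--
-- |A_r| is even iff -1 ∈ A_r, iff r ≡ 1 (mod 2^k).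
--
-- By the Chinese remainder theorem the permutation of ℤ_{N,2^(k-1)}^* has parity
-- |A_q| D_p + |A_p| D_q, and that of ℤ_{N,2^(k-1)} has (|A_q| + 1) D_p + (|A_p| + 1) D_q.
-- Both are compared with D_p + D_q by the cases p ≡ 1, q ≡ 1 (mod 2^k).
module Submission where

open import Defs
open import Algebra.Bundles using (CommutativeRing)
open import Algebra.Properties.CommutativeSemigroup as CommutativeSemigroup using ()
open import Data.Bool using (Bool; true; false; not; _xor_; _∧_; if_then_else_)
open import Data.Bool.Properties
  using (not-involutive; xor-same; xor-assoc; xor-comm; xor-identityʳ; xor-∧-commutativeRing)
open import Data.Empty using (⊥-elim)
open import Data.Integer using (ℤ; 1ℤ; -1ℤ) renaming (_*_ to _*ℤ_; _^_ to _^ℤ_)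
import Data.Integer.Properties as ℤ
open import Data.List using (List; []; _∷_; _++_; map; length; upTo; filter; cartesianProduct)
open import Data.List.Membership.DecPropositional using (_∈?_)
open import Data.List.Membership.Propositional using (_∈_; lose; find)
open import Data.List.Membership.Propositional.Properties
  using (∈-∃++; ∈-map⁺; ∈-map⁻; ∈-upTo⁺; ∈-upTo⁻; ∈-filter⁺; ∈-filter⁻;
         ∈-cartesianProduct⁺; ∈-cartesianProduct⁻)
open import Data.List.Membership.Propositional.Properties.WithK using (unique∧set⇒bag)
open import Data.List.Properties using (length-map; length-upTo; map-∘)
open import Data.List.Relation.Binary.BagAndSetEquality using (∼bag⇒↭)
open import Data.List.Relation.Binary.Permutation.Propositional as ↭
  using (_↭_; ↭-sym; ↭-trans; ↭-reflexive)
open import Data.List.Relation.Binary.Permutation.Propositional.Properties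
  using (∈-resp-↭; ↭-length; shift; All-resp-↭) renaming (map⁺ to ↭-map⁺)
open import Data.List.Relation.Unary.All as All using ([]; _∷_)
open import Data.List.Relation.Unary.AllPairs using (AllPairs; []; _∷_)
import Data.List.Relation.Unary.AllPairs.Properties as AllPairs
open import Data.List.Relation.Unary.Any using (here; there; any?; satisfied)
open import Data.List.Relation.Unary.Unique.Propositional using (Unique)
open import Data.List.Relation.Unary.Unique.Propositional.Properties
  using (upTo⁺; filter⁺; cartesianProduct⁺) renaming (map⁺ to unique-map⁺)
open import Data.Nat hiding (parity)
open import Data.Nat.Coprimality as Coprime
  using (Coprime; coprime-divisor; coprime⇒gcd≡1; gcd≡1⇒coprime; prime⇒coprime; 1-coprimeTo)
open import Data.Nat.Divisibility
open import Data.Nat.DivMod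
  using (m≡m%n+[m/n]*n; m%n%n≡m%n; m%n<n; m<n⇒m%n≡m; %-distribˡ-*; %-remove-+ʳ)
open import Data.Nat.GCD using (gcd)
open import Data.Nat.ListAction using (product)
open import Data.Nat.ListAction.Properties using (product-↭)
open import Data.Nat.Primality using (Prime; prime⇒nonZero; prime⇒nonTrivial; euclidsLemma)
open import Data.Nat.Properties
open import Data.Nat.Tactic.RingSolver using (solve-∀)
open import Data.Product using (∃; ∃₂; _×_; _,_; proj₁; proj₂)
  renaming (map to _×′_; swap to ×-swap)
open import Data.Product.Properties using (≡-dec)
open import Data.Sum using (_⊎_; inj₁; inj₂)
open import Function using (_∘_; id; case_of_; mk⇔)
open import Relation.Binary.Definitions using (DecidableEquality; tri<; tri≈; tri>)
open import Relation.Binary.PropositionalEquality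
open import Relation.Nullary using (¬_; Dec; yes; no; does)
open import Relation.Nullary.Decidable
  using (map′; ¬?; decidable-stable; dec-true; dec-false; does-⇔; _×-dec_)

open CommutativeSemigroup (CommutativeRing.+-commutativeSemigroup xor-∧-commutativeRing)
  using () renaming (interchange to xor-interchange)

-- `sgn` counts inversions for the order of ℕ, which neither a rearrangement of the list nor the
-- passage to pairs of residues respects. Parity is therefore taken relative to any tournament c, as
-- the sum modulo 2 of c x y + c (f x) (f y) over pairs. Two tournaments differ by a symmetric
-- function of pairs, which a permutation only rearranges, so the choice of c drops out.
--
-- Counting with involutions stands in for a primitive root: cyclicity of the unit group is never
-- invoked. That -1 lies in A_r exactly when 2^k divides r - 1 comes from Fermat in one direction,
-- and in the other from a nonsquare g, for which g^((r-1)/2) = -1.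
--
-- The closing comparison works because D_r vanishes whenever r is not 1 modulo 2^k. If N ≡ 1, then
-- p ≡ 1 iff q ≡ 1, so either both coefficients are odd or D_p = D_q = 0. If N is not 1, at most one
-- of the primes is; should it be p, then D_q = 0 and the coefficient |A_q| of D_p is odd.

private variable
  A B C : Set

-- Parity of permutations of lists

xor-cancelˡ : ∀ a b → a xor (a xor b) ≡ b
xor-cancelˡ a b = trans (sym (xor-assoc a a b)) (cong (_xor b) (xor-same a))

xor-cancel-mid : ∀ a b c → (a xor b) xor (b xor c) ≡ a xor c
xor-cancel-mid a b c = trans (xor-assoc a b (b xor c)) (cong (a xor_) (xor-cancelˡ b c))

odd : ℕ → Bool
odd zero    = false
odd (suc n) = not (odd n)

odd-+ : ∀ m n → odd (m + n) ≡ odd m xor odd n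
odd-+ zero    n = refl
odd-+ (suc m) n rewrite odd-+ m n with odd m | odd n
... | true  | true  = refl
... | true  | false = refl
... | false | true  = refl
... | false | false = refl

⨁ : (A → Bool) → List A → Bool
⨁ t []      = false
⨁ t (x ∷ L) = t x xor ⨁ t L

⨁-cong : ∀ {s t : A → Bool} L → (∀ {x} → x ∈ L → s x ≡ t x) → ⨁ s L ≡ ⨁ t L
⨁-cong []      eq = refl
⨁-cong (x ∷ L) eq = cong₂ _xor_ (eq (here refl)) (⨁-cong L (eq ∘ there))

⨁-xor : ∀ (s t : A → Bool) L → ⨁ (λ x → s x xor t x) L ≡ ⨁ s L xor ⨁ t L
⨁-xor s t []      = refl
⨁-xor s t (x ∷ L) =
  trans (cong ((s x xor t x) xor_) (⨁-xor s t L)) (xor-interchange (s x) (t x) _ _)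

⨁-map : ∀ (t : B → Bool) (f : A → B) L → ⨁ t (map f L) ≡ ⨁ (t ∘ f) L
⨁-map t f []      = refl
⨁-map t f (x ∷ L) = cong (t (f x) xor_) (⨁-map t f L)

⨁-++ : ∀ (t : A → Bool) L M → ⨁ t (L ++ M) ≡ ⨁ t L xor ⨁ t M
⨁-++ t []      M = refl
⨁-++ t (x ∷ L) M = trans (cong (t x xor_) (⨁-++ t L M)) (sym (xor-assoc (t x) _ _))

⨁-↭ : ∀ (t : A → Bool) {L M} → L ↭ M → ⨁ t L ≡ ⨁ t M
⨁-↭ t ↭.refl         = refl
⨁-↭ t (↭.prep x p)   = cong (t x xor_) (⨁-↭ t p)
⨁-↭ t (↭.trans p q)  = trans (⨁-↭ t p) (⨁-↭ t q)
⨁-↭ t (↭.swap {xs = L} x y p) = begin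
  t x xor (t y xor ⨁ t L)    ≡⟨ xor-assoc (t x) (t y) _ ⟨
  (t x xor t y) xor ⨁ t L    ≡⟨ cong₂ _xor_ (xor-comm (t x) (t y)) (⨁-↭ t p) ⟩
  (t y xor t x) xor _        ≡⟨ xor-assoc (t y) (t x) _ ⟩
  t y xor (t x xor _)        ∎
  where open ≡-Reasoning

⨁² : (A → A → Bool) → List A → List A → Bool
⨁² t L M = ⨁ (λ x → ⨁ (t x) M) L

⨁²-↭ : ∀ (t : A → A → Bool) {L L′ M M′} → L ↭ L′ → M ↭ M′ → ⨁² t L M ≡ ⨁² t L′ M′
⨁²-↭ t {L} p q = trans (⨁-cong L (λ {x} _ → ⨁-↭ (t x) q)) (⨁-↭ _ p)

⨁²-map : ∀ (t : B → B → Bool) (f : A → B) L M →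
  ⨁² t (map f L) (map f M) ≡ ⨁² (λ x y → t (f x) (f y)) L M
⨁²-map t f L M = trans (⨁-map _ f L) (⨁-cong L (λ {x} _ → ⨁-map (t (f x)) f M))

⨁²-xor : ∀ (s t : A → A → Bool) L M →
  ⨁² (λ x y → s x y xor t x y) L M ≡ ⨁² s L M xor ⨁² t L M
⨁²-xor s t L M = trans (⨁-cong L (λ {x} _ → ⨁-xor (s x) (t x) M)) (⨁-xor _ _ L)

pairs : (A → A → Bool) → List A → Bool
pairs t []      = false
pairs t (x ∷ L) = ⨁ (t x) L xor pairs t L

pairs-cong : ∀ {s t : A → A → Bool} L →
  (∀ {x y} → x ∈ L → y ∈ L → s x y ≡ t x y) → pairs s L ≡ pairs t L
pairs-cong []      eq = refl
pairs-cong (x ∷ L) eq =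
  cong₂ _xor_ (⨁-cong L (eq (here refl) ∘ there)) (pairs-cong L (λ i j → eq (there i) (there j)))

pairs-xor : ∀ (s t : A → A → Bool) L →
  pairs (λ x y → s x y xor t x y) L ≡ pairs s L xor pairs t L
pairs-xor s t []      = refl
pairs-xor s t (x ∷ L) =
  trans (cong₂ _xor_ (⨁-xor (s x) (t x) L) (pairs-xor s t L)) (xor-interchange (⨁ (s x) L) _ _ _)

pairs-map : ∀ (t : B → B → Bool) (f : A → B) L →
  pairs t (map f L) ≡ pairs (λ x y → t (f x) (f y)) L
pairs-map t f []      = refl
pairs-map t f (x ∷ L) = cong₂ _xor_ (⨁-map (t (f x)) f L) (pairs-map t f L)

pairs-++ : ∀ (t : A → A → Bool) L M →
  pairs t (L ++ M) ≡ (pairs t L xor pairs t M) xor ⨁² t L M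
pairs-++ t []      M = sym (xor-identityʳ _)
pairs-++ t (x ∷ L) M = begin
  ⨁ (t x) (L ++ M) xor pairs t (L ++ M)
    ≡⟨ cong₂ _xor_ (⨁-++ (t x) L M) (pairs-++ t L M) ⟩
  (⨁ (t x) L xor ⨁ (t x) M) xor ((pairs t L xor pairs t M) xor ⨁² t L M)
    ≡⟨ xor-interchange (⨁ (t x) L) _ _ _ ⟩
  (⨁ (t x) L xor (pairs t L xor pairs t M)) xor (⨁ (t x) M xor ⨁² t L M)
    ≡⟨ cong (_xor (⨁ (t x) M xor ⨁² t L M)) (xor-assoc (⨁ (t x) L) _ _) ⟨
  ((⨁ (t x) L xor pairs t L) xor pairs t M) xor ⨁² t (x ∷ L) M ∎
  where open ≡-Reasoning

SymmetricOn : (A → A → Bool) → List A → Set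
SymmetricOn t L = ∀ {x y} → x ∈ L → y ∈ L → t x y ≡ t y x

-- A swap of neighbours turns around just one pair, the two neighbours themselves; this is where the
-- symmetry of `t` is consumed.
pairs-↭ : ∀ {t : A → A → Bool} {L M} → SymmetricOn t L → L ↭ M → pairs t L ≡ pairs t M
pairs-↭ s ↭.refl        = refl
pairs-↭ s (↭.prep x p)  =
  cong₂ _xor_ (⨁-↭ _ p) (pairs-↭ (λ i j → s (there i) (there j)) p)
pairs-↭ s (↭.trans p q) =
  trans (pairs-↭ s p) (pairs-↭ (λ i j → s (∈-resp-↭ (↭-sym p) i) (∈-resp-↭ (↭-sym p) j)) q)
pairs-↭ {t = t} s (↭.swap {xs = L} {ys = M} x y p) = begin
  (t x y xor ⨁ (t x) L) xor (⨁ (t y) L xor pairs t L)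
    ≡⟨ xor-interchange (t x y) _ _ _ ⟩
  (t x y xor ⨁ (t y) L) xor (⨁ (t x) L xor pairs t L)
    ≡⟨ cong₂ _xor_ (cong₂ _xor_ (s (here refl) (there (here refl))) (⨁-↭ _ p))
                   (cong₂ _xor_ (⨁-↭ _ p) (pairs-↭ (λ i j → s (there (there i)) (there (there j))) p)) ⟩
  (t y x xor ⨁ (t y) M) xor (⨁ (t x) M xor pairs t M) ∎
  where open ≡-Reasoning

-- The parity of a permutation f of L does not depend on the reference relation
-- c as long as c is a tournament; this frees it from the order on ℕ.
parity : (A → A → Bool) → (A → A) → List A → Bool
parity c f = pairs (λ x y → c x y xor c (f x) (f y))

Tournament : (A → A → Bool) → Set
Tournament c = ∀ {x y} → x ≢ y → c x y ≡ not (c y x)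

InjectiveOn : (A → B) → List A → Set
InjectiveOn f L = ∀ {x y} → x ∈ L → y ∈ L → f x ≡ f y → x ≡ y

parity-cong : ∀ (c : A → A → Bool) {f g} L → (∀ {x} → x ∈ L → f x ≡ g x) →
  parity c f L ≡ parity c g L
parity-cong c L eq = pairs-cong L (λ i j → cong₂ (λ a b → c _ _ xor c a b) (eq i) (eq j))

-- Since `f` permutes each block, the cross terms `c x y` and `c (f x) (f y)` have the same sum over
-- `L` × `M`, and the two sums cancel modulo 2.
parity-++ : ∀ (c : A → A → Bool) f L M → map f L ↭ L → map f M ↭ M →
  parity c f (L ++ M) ≡ parity c f L xor parity c f M
parity-++ c f L M p q = begin
  parity c f (L ++ M)
    ≡⟨ pairs-++ _ L M ⟩
  (parity c f L xor parity c f M) xor ⨁² (λ x y → c x y xor c (f x) (f y)) L M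
    ≡⟨ cong ((parity c f L xor parity c f M) xor_) cross ⟩
  (parity c f L xor parity c f M) xor false
    ≡⟨ xor-identityʳ _ ⟩
  parity c f L xor parity c f M ∎
  where
  open ≡-Reasoning
  cross : ⨁² (λ x y → c x y xor c (f x) (f y)) L M ≡ false
  cross = begin
    ⨁² (λ x y → c x y xor c (f x) (f y)) L M     ≡⟨ ⨁²-xor c _ L M ⟩
    ⨁² c L M xor ⨁² (λ x y → c (f x) (f y)) L M  ≡⟨ cong (⨁² c L M xor_) (⨁²-map c f L M) ⟨
    ⨁² c L M xor ⨁² c (map f L) (map f M)        ≡⟨ cong (⨁² c L M xor_) (⨁²-↭ c p q) ⟩
    ⨁² c L M xor ⨁² c L M                        ≡⟨ xor-same (⨁² c L M) ⟩
    false ∎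

parity-map : ∀ (c : B → B → Bool) {f : B → B} {g : A → A} (e : A → B) L →
  (∀ {x} → x ∈ L → f (e x) ≡ e (g x)) →
  parity c f (map e L) ≡ parity (λ x y → c (e x) (e y)) g L
parity-map c e L eq = trans (pairs-map _ e L)
  (pairs-cong L (λ i j → cong₂ (λ a b → c _ _ xor c a b) (eq i) (eq j)))

module _ (_≟_ : DecidableEquality A) where

  -- Turning a pair around negates both summands, and the two negations cancel. Thus `pairs-↭`
  -- applies to differences of tournaments, although a tournament itself is not symmetric.
  xor-symmetric : ∀ {c : B → B → Bool} {d : C → C → Bool} {f : A → B} {g : A → C} {L} →
    Tournament c → Tournament d → InjectiveOn f L → InjectiveOn g L →
    SymmetricOn (λ x y → c (f x) (f y) xor d (g x) (g y)) L
  xor-symmetric {c = c} {d} {f} {g} T T′ F G {x} {y} i j with x ≟ y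
  ... | yes refl = refl
  ... | no  x≢y rewrite T (x≢y ∘ F i j) | T′ (x≢y ∘ G i j)
      with c (f y) (f x) | d (g y) (g x)
  ... | true  | true  = refl
  ... | true  | false = refl
  ... | false | true  = refl
  ... | false | false = refl

  parity-↭ : ∀ {c : A → A → Bool} {f L M} → Tournament c → InjectiveOn f L → L ↭ M →
    parity c f L ≡ parity c f M
  parity-↭ T F p = pairs-↭ (xor-symmetric T T (λ _ _ → id) F) p

  -- The two parities differ by the sum of `t x y xor t (f x) (f y)` for the symmetric `t` below;
  -- its halves are sums of `t` over `L` and over `map f L`. The map `e` lets the second tournament
  -- live on another set.
  parity-tournament : ∀ {c : A → A → Bool} {d : B → B → Bool} (e : A → B) {f L} →
    Tournament c → Tournament d → InjectiveOn e L → map f L ↭ L →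
    parity c f L ≡ parity (λ x y → d (e x) (e y)) f L
  parity-tournament {c = c} {d} e {f} {L} T T′ E p = begin
    parity c f L                                      ≡⟨ xor-cancelˡ (parity d′ f L) _ ⟨
    parity d′ f L xor (parity d′ f L xor parity c f L) ≡⟨ cong (parity d′ f L xor_) agree ⟩
    parity d′ f L xor false                           ≡⟨ xor-identityʳ _ ⟩
    parity d′ f L                                     ∎
    where
    open ≡-Reasoning
    d′ t : A → A → Bool
    d′ x y = d (e x) (e y)
    t x y = d′ x y xor c x y
    agree : parity d′ f L xor parity c f L ≡ false
    agree = begin
      parity d′ f L xor parity c f L
        ≡⟨ pairs-xor _ _ L ⟨
      pairs (λ x y → (d′ x y xor d′ (f x) (f y)) xor (c x y xor c (f x) (f y))) L
        ≡⟨ pairs-cong L (λ {x} {y} _ _ → xor-interchange (d′ x y) _ _ _) ⟩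
      pairs (λ x y → t x y xor t (f x) (f y)) L
        ≡⟨ pairs-xor t _ L ⟩
      pairs t L xor pairs (λ x y → t (f x) (f y)) L
        ≡⟨ cong (pairs t L xor_) (pairs-map t f L) ⟨
      pairs t L xor pairs t (map f L)
        ≡⟨ cong (pairs t L xor_) (pairs-↭ (xor-symmetric T′ T E (λ _ _ → id)) (↭-sym p)) ⟨
      pairs t L xor pairs t L
        ≡⟨ xor-same (pairs t L) ⟩
      false ∎

  -- Inserting `c (f x) (f y)` twice splits each term in two. The second half is the parity of `g`
  -- summed over `map f L`, a rearrangement of `L`.
  parity-∘ : ∀ {c : A → A → Bool} {f g L} → Tournament c → map f L ↭ L → InjectiveOn g L →
    parity c (g ∘ f) L ≡ parity c f L xor parity c g L
  parity-∘ {c} {f} {g} {L} T p G = begin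
    pairs (λ x y → c x y xor c (g (f x)) (g (f y))) L
      ≡⟨ pairs-cong L (λ {x} {y} _ _ → xor-cancel-mid (c x y) (c (f x) (f y)) _) ⟨
    pairs (λ x y → (c x y xor c (f x) (f y)) xor t (f x) (f y)) L
      ≡⟨ pairs-xor _ _ L ⟩
    parity c f L xor pairs (λ x y → t (f x) (f y)) L
      ≡⟨ cong (parity c f L xor_) (pairs-map t f L) ⟨
    parity c f L xor pairs t (map f L)
      ≡⟨ cong (parity c f L xor_) (pairs-↭ (xor-symmetric T T (λ _ _ → id) G) (↭-sym p)) ⟨
    parity c f L xor parity c g L ∎
    where
    open ≡-Reasoning
    t : A → A → Bool
    t x y = c x y xor c (g x) (g y)

-- Duplicate-free lists as finite sets; involutions and permutations on them

set⇒↭ : ∀ {L M : List A} → Unique L → Unique M →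
  (∀ {x} → x ∈ L → x ∈ M) → (∀ {x} → x ∈ M → x ∈ L) → L ↭ M
set⇒↭ u v to from = ∼bag⇒↭ (unique∧set⇒bag u v (mk⇔ to from))

∈⇒↭∷ : ∀ {x : A} {L} → x ∈ L → ∃ λ M → L ↭ x ∷ M
∈⇒↭∷ {x = x} i with ∈-∃++ i
... | ys , zs , refl = ys ++ zs , shift x ys zs

-- The pigeonhole principle, used for the surjectivity of injective self-maps and for the existence
-- of a nonsquare modulo p.
unique-⊆⇒length≤ : ∀ {L M : List A} → Unique L → (∀ {x} → x ∈ L → x ∈ M) → length L ≤ length M
unique-⊆⇒length≤ []          sub = z≤n
unique-⊆⇒length≤ {M = M} (_∷_ {x} {L} x∉L u) sub with ∈⇒↭∷ (sub (here refl))
... | M′ , p = subst (suc (length L) ≤_) (sym (↭-length p)) (s≤s (unique-⊆⇒length≤ u sub′))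
  where
  sub′ : ∀ {y} → y ∈ L → y ∈ M′
  sub′ i with ∈-resp-↭ p (sub (there i))
  ... | here refl = ⊥-elim (All.lookup x∉L i refl)
  ... | there j     = j

Unique-resp-↭ : ∀ {L M : List A} → L ↭ M → Unique L → Unique M
Unique-resp-↭ ↭.refl        u = u
Unique-resp-↭ (↭.prep x p)  (a ∷ u) = All-resp-↭ p a ∷ Unique-resp-↭ p u
Unique-resp-↭ (↭.swap x y p) ((x≢y ∷ a) ∷ b ∷ u) =
  ((x≢y ∘ sym) ∷ All-resp-↭ p b) ∷ All-resp-↭ p a ∷ Unique-resp-↭ p u
Unique-resp-↭ (↭.trans p q) u = Unique-resp-↭ q (Unique-resp-↭ p u)

-- F lists the fixed points of the involution f, and R one element of each 2-cycle.
data Orbits (f : A → A) : (F R L : List A) → Set where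
  []   : Orbits f [] [] []
  fix  : ∀ {x F R L} → f x ≡ x → Orbits f F R L → Orbits f (x ∷ F) R (x ∷ L)
  flip : ∀ {x F R L} → f x ≢ x → f (f x) ≡ x → Orbits f F R L → Orbits f F (x ∷ R) (x ∷ f x ∷ L)

record InvolutionOn (f : A → A) (L : List A) : Set where
  field
    closed     : ∀ {x} → x ∈ L → f x ∈ L
    involutive : ∀ {x} → x ∈ L → f (f x) ≡ x

  injective : InjectiveOn f L
  injective i j eq = trans (sym (involutive i)) (trans (cong f eq) (involutive j))

module _ {f : A → A} where

  orbits-map : ∀ {F R L} → Orbits f F R L → map f L ↭ L
  orbits-map []                = ↭.refl
  orbits-map (fix {x} {L = L} e o) = ↭-trans (↭-reflexive (cong (_∷ map f L) e)) (↭.prep x (orbits-map o))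
  orbits-map (flip {x} {L = L} _ e o) =
    ↭-trans (↭-reflexive (cong (λ z → f x ∷ z ∷ map f L) e)) (↭.swap (f x) x (orbits-map o))

  orbits-length : ∀ {F R L} → Orbits f F R L → length L ≡ length F + (length R + length R)
  orbits-length []          = refl
  orbits-length (fix _ o)   = cong suc (orbits-length o)
  orbits-length (flip {F = F} {R = R} _ _ o) = trans (cong (suc ∘ suc) (orbits-length o))
    (trans (cong suc (sym (+-suc (length F) _)))
      (trans (sym (+-suc (length F) _)) (cong (λ z → length F + suc z) (sym (+-suc (length R) _)))))

  orbits-fixed : ∀ {F R L} → Orbits f F R L → ∀ {x} → x ∈ L → f x ≡ x → x ∈ F
  orbits-fixed (fix _ o)    (here refl) e = here refl
  orbits-fixed (fix _ o)    (there i)     e = there (orbits-fixed o i e)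
  orbits-fixed (flip n _ o) (here refl) e = ⊥-elim (n e)
  orbits-fixed (flip n d o) (there (here refl)) e = ⊥-elim (n (trans (sym e) d))
  orbits-fixed (flip _ _ o) (there (there i))     e = orbits-fixed o i e

  orbits-F : ∀ {F R L} → Orbits f F R L → ∀ {x} → x ∈ F → x ∈ L × f x ≡ x
  orbits-F (fix e o)    (here refl) = here refl , e
  orbits-F (fix e o)    (there i)     = let j , e′ = orbits-F o i in there j , e′
  orbits-F (flip _ _ o) i             = let j , e′ = orbits-F o i in there (there j) , e′

  orbits-F-unique : ∀ {F R L} → Orbits f F R L → Unique L → Unique F
  orbits-F-unique []           u             = []
  orbits-F-unique (fix e o)    (a ∷ u)       =
    All.tabulate (λ i → All.lookup a (proj₁ (orbits-F o i))) ∷ orbits-F-unique o u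
  orbits-F-unique (flip _ _ o) (_ ∷ _ ∷ u)   = orbits-F-unique o u

  -- Fixed points and 2-cycles are stable blocks of parity 0 and 1, so `parity-++` adds them up.
  orbits-parity : ∀ {c : A → A → Bool} → Tournament c →
    ∀ {F R L} → Orbits f F R L → parity c f L ≡ odd (length R)
  orbits-parity T []                     = refl
  orbits-parity {c} T (fix {x} {L = L} e o) = trans
    (parity-++ c f (x ∷ []) L (↭-reflexive (cong (_∷ []) e)) (orbits-map o))
    (orbits-parity T o)
  orbits-parity {c} T (flip {x} {L = L} n e o) = trans
    (parity-++ c f (x ∷ f x ∷ []) L
      (↭-trans (↭-reflexive (cong (λ z → f x ∷ z ∷ []) e)) (↭.swap (f x) x ↭.refl)) (orbits-map o))
    (cong₂ _xor_ swapped (orbits-parity T o))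
    where
    swapped : ((c x (f x) xor c (f x) (f (f x))) xor false) xor false ≡ true
    swapped rewrite e | T (n ∘ sym) with c (f x) x
    ... | true  = refl
    ... | false = refl

  module _ (_≟_ : DecidableEquality A) where

    -- The partner `f x` sits anywhere in the tail, so removing a 2-cycle is not structural;
    -- recursion runs on a bound for the length. The list is rearranged to `M`, where partners are
    -- adjacent.
    orbits-≤ : ∀ n L → length L ≤ n → Unique L → InvolutionOn f L →
      ∃₂ λ F R → ∃ λ M → L ↭ M × Orbits f F R M
    orbits-≤ n       []      _        _       _   = [] , [] , [] , ↭.refl , []
    orbits-≤ (suc n) (x ∷ L) (s≤s l) (a ∷ u) inv with f x ≟ x
    ... | yes e =
      let F , R , M , p , o = orbits-≤ n L l u record { closed = cl ; involutive = involutive ∘ there }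
      in x ∷ F , R , x ∷ M , ↭.prep x p , fix e o
      where
      open InvolutionOn inv
      cl : ∀ {y} → y ∈ L → f y ∈ L
      cl i with closed (there i)
      ... | there j = j
      ... | here e′ = ⊥-elim (All.lookup a i (injective (here refl) (there i) (trans e (sym e′))))
    ... | no  fx≢x with InvolutionOn.closed inv (here refl)
    ...   | here e   = ⊥-elim (fx≢x e)
    ...   | there fx∈L with ∈⇒↭∷ fx∈L
    ...     | L′ , p with Unique-resp-↭ p u
    ...       | b ∷ u′ =
      let F , R , M , q , o = orbits-≤ n L′ l′ u′
            record { closed = cl ; involutive = involutive ∘ there ∘ up ∘ there }
      in F , x ∷ R , x ∷ f x ∷ M , ↭.prep x (↭-trans p (↭.prep (f x) q)) ,
         flip fx≢x (involutive (here refl)) o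
      where
      open InvolutionOn inv
      l′ : length L′ ≤ n
      l′ = ≤-trans (n≤1+n _) (≤-trans (≤-reflexive (sym (↭-length p))) l)
      up : ∀ {y} → y ∈ f x ∷ L′ → y ∈ L
      up = ∈-resp-↭ (↭-sym p)
      -- By injectivity only `x` is sent to `f x` and only `f x` to `x`, so deleting both leaves a
      -- stable list.
      cl : ∀ {y} → y ∈ L′ → f y ∈ L′
      cl {y} i with closed (there (up (there i)))
      ... | here e = ⊥-elim (All.lookup b i
              (injective (there (up (here refl))) (there (up (there i)))
                (trans (involutive (here refl)) (sym e))))
      ... | there j with ∈-resp-↭ p j
      ...   | there k = k
      ...   | here e  = ⊥-elim (All.lookup a (up (there i))
                (injective (here refl) (there (up (there i))) (sym e)))

    orbits : ∀ {L} → Unique L → InvolutionOn f L →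
      ∃₂ λ F R → ∃ λ M → L ↭ M × Orbits f F R M
    orbits {L} = orbits-≤ (length L) L ≤-refl

unique-map : ∀ {f : A → B} {L} → Unique L → InjectiveOn f L → Unique (map f L)
unique-map []      inj = []
unique-map {f = f} {x ∷ L} (a ∷ u) inj =
  All.tabulate fx∉ ∷ unique-map u (λ i j → inj (there i) (there j))
  where
  fx∉ : ∀ {y} → y ∈ map f L → f x ≢ y
  fx∉ i e with ∈-map⁻ f i
  ... | z , j , refl = All.lookup a j (inj (here refl) (there j) e)

record PermutationOn (f : A → A) (L : List A) : Set where
  field
    unique    : Unique L
    closed    : ∀ {x} → x ∈ L → f x ∈ L
    injective : InjectiveOn f L

-- Were some `x` of `L` missed by `f`, then `x ∷ map f L` would be a list of distinct members of `L`
-- that is longer than `L`.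
permutation-↭ : DecidableEquality A → ∀ {f : A → A} {L} → PermutationOn f L → map f L ↭ L
permutation-↭ _≟_ {f} {L} perm = set⇒↭ fL-unique unique to from
  where
  open PermutationOn perm
  fL-unique : Unique (map f L)
  fL-unique = unique-map unique injective
  to : ∀ {x} → x ∈ map f L → x ∈ L
  to i with ∈-map⁻ f i
  ... | y , j , refl = closed j
  from : ∀ {x} → x ∈ L → x ∈ map f L
  from {x} i with _∈?_ _≟_ x (map f L)
  ... | yes j  = j
  ... | no  x∉ = ⊥-elim (1+n≰n (subst (λ l → suc l ≤ length L) (length-map f L)
          (unique-⊆⇒length≤ {L = x ∷ map f L} (All.tabulate (λ { j refl → x∉ j }) ∷ fL-unique)
            (λ { (here refl) → i ; (there j) → to j }))))

-- Congruences and power residues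

half : ∀ n → ∃ λ h → n ≡ h + h ⊎ n ≡ suc (h + h)
half zero    = 0 , inj₁ refl
half (suc n) with half n
... | h , inj₁ e = h , inj₂ (cong suc e)
... | h , inj₂ e = suc h , inj₁ (cong suc (trans e (sym (+-suc h h))))

odd-double : ∀ n → odd (n + n) ≡ false
odd-double n = trans (odd-+ n n) (xor-same (odd n))

^-distribʳ-* : ∀ a b e → (a * b) ^ e ≡ a ^ e * b ^ e
^-distribʳ-* a b zero    = refl
^-distribʳ-* a b (suc e) =
  trans (cong (a * b *_) (^-distribʳ-* a b e)) (lemma a b (a ^ e) (b ^ e))
  where
  lemma : ∀ a b x y → a * b * (x * y) ≡ a * x * (b * y)
  lemma = solve-∀

modN-idem : ∀ a n → modN (modN a n) n ≡ modN a n
modN-idem a zero    = refl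
modN-idem a (suc n) = m%n%n≡m%n a (suc n)

modN< : ∀ a n .{{_ : NonZero n}} → modN a n < n
modN< a (suc n) = m%n<n a (suc n)

modN-small : ∀ {a n} → a < n → modN a n ≡ a
modN-small {n = suc n} = m<n⇒m%n≡m

infix 4 _≈_[_]
-- At modulus 0 this is equality, in agreement with divisibility by 0, so the basic rules hold for
-- every `n`.
_≈_[_] : ℕ → ℕ → ℕ → Set
a ≈ b [ n ] = modN a n ≡ modN b n

≈⇒≡ : ∀ n {a b} → a < n → b < n → a ≈ b [ n ] → a ≡ b
≈⇒≡ n i j e = trans (sym (modN-small i)) (trans e (modN-small j))

*-≈ : ∀ n {a b c d} → a ≈ b [ n ] → c ≈ d [ n ] → a * c ≈ b * d [ n ]
*-≈ zero    p q = cong₂ _*_ p q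
*-≈ (suc n) {a} {b} {c} {d} p q = trans (%-distribˡ-* a c (suc n))
  (trans (cong₂ (λ x y → (x * y) % suc n) p q) (sym (%-distribˡ-* b d (suc n))))

^-≈ : ∀ n e {a b} → a ≈ b [ n ] → a ^ e ≈ b ^ e [ n ]
^-≈ n zero    p = refl
^-≈ n (suc e) p = *-≈ n p (^-≈ n e p)

∣⇒≈ : ∀ n a {d} → n ∣ d → a + d ≈ a [ n ]
∣⇒≈ zero    a n∣d rewrite 0∣⇒≡0 n∣d = +-identityʳ a
∣⇒≈ (suc n) a n∣d = %-remove-+ʳ a n∣d

≈⇒∣ : ∀ n a {d} → a + d ≈ a [ n ] → n ∣ d
≈⇒∣ zero    a {d} e = subst (0 ∣_) (sym (+-cancelˡ-≡ a d 0 (trans e (sym (+-identityʳ a))))) (0 ∣0)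
≈⇒∣ (suc n) a {d} e = ∣m+n∣m⇒∣n (divides q₁ eq) (n∣m*n q₀)
  where
  q₀ q₁ : ℕ
  q₀ = a / suc n
  q₁ = (a + d) / suc n
  eq : q₀ * suc n + d ≡ q₁ * suc n
  eq = +-cancelˡ-≡ (a % suc n) _ _ (begin
    a % suc n + (q₀ * suc n + d)    ≡⟨ +-assoc (a % suc n) _ d ⟨
    a % suc n + q₀ * suc n + d      ≡⟨ cong (_+ d) (m≡m%n+[m/n]*n a (suc n)) ⟨
    a + d                           ≡⟨ m≡m%n+[m/n]*n (a + d) (suc n) ⟩
    (a + d) % suc n + q₁ * suc n    ≡⟨ cong (_+ q₁ * suc n) e ⟩
    a % suc n + q₁ * suc n          ∎)
    where open ≡-Reasoning

∣m+n-m∣≡n : ∀ m n → ∣ m + n - m ∣ ≡ n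
∣m+n-m∣≡n m n = trans (∣-∣-comm (m + n) m) (∣m-m+n∣≡n m n)

-- The distance `∣ a - b ∣` stands in for the integer difference. Multiplication distributes over
-- it, which turns cancellation modulo `n` into a statement on coprime divisors.
≈⇒∣-∣ : ∀ n a b → a ≈ b [ n ] → n ∣ ∣ a - b ∣
≈⇒∣-∣ n a b e with ≤-total a b
... | inj₁ a≤b with d , refl ← m≤n⇒∃[o]m+o≡n a≤b = subst (n ∣_) (sym (∣m-m+n∣≡n a d)) (≈⇒∣ n a (sym e))
... | inj₂ b≤a with d , refl ← m≤n⇒∃[o]m+o≡n b≤a = subst (n ∣_) (sym (∣m+n-m∣≡n b d)) (≈⇒∣ n b e)

∣-∣⇒≈ : ∀ n a b → n ∣ ∣ a - b ∣ → a ≈ b [ n ]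
∣-∣⇒≈ n a b n∣ with ≤-total a b
... | inj₁ a≤b with d , refl ← m≤n⇒∃[o]m+o≡n a≤b = sym (∣⇒≈ n a (subst (n ∣_) (∣m-m+n∣≡n a d) n∣))
... | inj₂ b≤a with d , refl ← m≤n⇒∃[o]m+o≡n b≤a = ∣⇒≈ n b (subst (n ∣_) (∣m+n-m∣≡n b d) n∣)

*-cancel-≈ : ∀ n {m} → Coprime m n → ∀ x y → m * x ≈ m * y [ n ] → x ≈ y [ n ]
*-cancel-≈ n {m} co x y e = ∣-∣⇒≈ n x y (coprime-divisor (Coprime.sym co)
  (subst (n ∣_) (sym (*-distribˡ-∣-∣ m x y)) (≈⇒∣-∣ n (m * x) (m * y) e)))

coprime-≈ : ∀ n {a b} → a ≈ b [ n ] → Coprime a n → Coprime b n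
coprime-≈ zero    refl co = co
coprime-≈ (suc n) {a} e co {d} (d∣b , d∣n) =
  co (∣n∣m%n⇒∣m {n = suc n} d∣n (subst (d ∣_) (sym e) (%-presˡ-∣ {n = suc n} d∣b d∣n)) , d∣n)

coprime-* : ∀ {n a b} → Coprime a n → Coprime b n → Coprime (a * b) n
coprime-* {n} {a} ca cb {d} (d∣ab , d∣n) = cb (coprime-divisor d⊥a d∣ab , d∣n)
  where
  d⊥a : Coprime d a
  d⊥a (e∣d , e∣a) = ca (e∣a , ∣-trans e∣d d∣n)

coprime-^ : ∀ {n a} e → Coprime a n → Coprime (a ^ e) n
coprime-^ {n} zero    ca = 1-coprimeTo n
coprime-^     (suc e) ca = coprime-* ca (coprime-^ e ca)

coprime-factorˡ : ∀ {n a} b → Coprime (a * b) n → Coprime a n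
coprime-factorˡ b co (d∣a , d∣n) = co (∣m⇒∣m*n b d∣a , d∣n)

record Power (j n a : ℕ) : Set where
  constructor _,_
  field
    root    : ℕ
    root-^≈ : root ^ (2 ^ j) ≈ a [ n ]

power-≈ : ∀ j n {a b} → a ≈ b [ n ] → Power j n a → Power j n b
power-≈ j n e (x , p) = x , trans p e

power-* : ∀ j n {a b} → Power j n a → Power j n b → Power j n (a * b)
power-* j n (x , p) (y , q) =
  x * y , trans (cong (λ z → modN z n) (^-distribʳ-* x y (2 ^ j))) (*-≈ n p q)

power-1 : ∀ j n → Power j n 1
power-1 j n = 1 , cong (λ z → modN z n) (^-zeroˡ (2 ^ j))

power-^ : ∀ j n {a} e → Power j n a → Power j n (a ^ e)
power-^ j n zero    p = power-1 j n
power-^ j n (suc e) p = power-* j n p (power-^ j n e p)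

^-2^suc : ∀ x j → x ^ (2 ^ suc j) ≡ x ^ (2 ^ j) * x ^ (2 ^ j)
^-2^suc x j = trans (cong (λ e → x ^ (2 ^ j + e)) (+-identityʳ (2 ^ j))) (^-distribˡ-+-* x (2 ^ j) (2 ^ j))

-- Squaring a 2^j-th power doubles the exponent, so the same base serves as root.
power-suc : ∀ j n {a y} → Power j n y → y * y ≈ a [ n ] → Power (suc j) n a
power-suc j n (x , p) e =
  x , trans (cong (λ z → modN z n) (^-2^suc x j)) (trans (*-≈ n p p) e)

power-base-coprime : ∀ j n {a} x → x ^ (2 ^ j) ≈ a [ n ] → Coprime a n → Coprime x n
power-base-coprime j n x p co = lemma (2 ^ j) (m^n>0 2 j) (coprime-≈ n (sym p) co)
  where
  lemma : ∀ e → 0 < e → Coprime (x ^ e) _ → Coprime x _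
  lemma (suc e) _ = coprime-factorˡ (x ^ e)

module _ (j n : ℕ) .{{_ : NonZero n}} where

  -- Any root may be reduced modulo `n`, so the finite search of `isPow2kRes?` decides. `map′` keeps
  -- the Boolean of that search, hence `does (power? a)` is the very test inside `powSym`.
  power? : ∀ a → Dec (Power j n a)
  power? a = map′ (λ w → let x , p = satisfied w in x , p)
    (λ (x , p) → lose (∈-upTo⁺ (modN< x n)) (trans (^-≈ n (2 ^ j) (modN-idem x n)) p))
    (isPow2kRes? j n a)

  ∈-Zpow⁺ : ∀ {r} → r < n → Power j n r → r ∈ Zpow n j
  ∈-Zpow⁺ {r} r<n (x , p) = ∈-filter⁺ (isPow2kRes? j n) (∈-upTo⁺ r<n)
    (lose (∈-upTo⁺ (modN< x n)) (trans (^-≈ n (2 ^ j) (modN-idem x n)) p))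

  ∈-Zpow⁻ : ∀ {r} → r ∈ Zpow n j → r < n × Power j n r
  ∈-Zpow⁻ i with ∈-filter⁻ (isPow2kRes? j n) i
  ... | k , p = let x , e = satisfied p in ∈-upTo⁻ k , (x , e)

  ∈-units⁺ : ∀ {r} → r < n → Coprime r n → Power j n r → r ∈ ZpowUnits n j
  ∈-units⁺ {r} r<n co (x , p) =
    ∈-filter⁺ (λ r → (gcd r n ≟ 1) ×-dec isPow2kRes? j n r) (∈-upTo⁺ r<n)
      (coprime⇒gcd≡1 co ,
       lose (∈-upTo⁺ (modN< x n)) (trans (^-≈ n (2 ^ j) (modN-idem x n)) p))

  ∈-units⁻ : ∀ {r} → r ∈ ZpowUnits n j → r < n × Coprime r n × Power j n r
  ∈-units⁻ i with ∈-filter⁻ (λ r → (gcd r n ≟ 1) ×-dec isPow2kRes? j n r) i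
  ... | k , g , p = let x , e = satisfied p in ∈-upTo⁻ k , gcd≡1⇒coprime g , (x , e)

Zpow-unique : ∀ n j → Unique (Zpow n j)
Zpow-unique n j = filter⁺ (isPow2kRes? j n) (upTo⁺ n)

units-unique : ∀ n j → Unique (ZpowUnits n j)
units-unique n j = filter⁺ (λ r → (gcd r n ≟ 1) ×-dec isPow2kRes? j n r) (upTo⁺ n)

module _ {m n : ℕ} .{{_ : NonZero n}} (co : Coprime m n) where

  phi-injective : ∀ {x y} → x < n → y < n → phi n m x ≡ phi n m y → x ≡ y
  phi-injective x<n y<n e = ≈⇒≡ n x<n y<n (*-cancel-≈ n co _ _ e)

  module _ j (pm : Power j n m) where

    phi-Zpow : PermutationOn (phi n m) (Zpow n j)
    phi-Zpow = record
      { unique    = Zpow-unique n j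
      ; closed    = λ {x} i → let _ , p = ∈-Zpow⁻ j n i in
          ∈-Zpow⁺ j n (modN< (m * x) n) (power-≈ j n (sym (modN-idem (m * x) n)) (power-* j n pm p))
      ; injective = λ i k → phi-injective (proj₁ (∈-Zpow⁻ j n i)) (proj₁ (∈-Zpow⁻ j n k))
      }

    phi-units : PermutationOn (phi n m) (ZpowUnits n j)
    phi-units = record
      { unique    = units-unique n j
      ; closed    = λ {x} i → let _ , c , p = ∈-units⁻ j n i; e = sym (modN-idem (m * x) n) in
          ∈-units⁺ j n (modN< (m * x) n) (coprime-≈ n e (coprime-* co c)) (power-≈ j n e (power-* j n pm p))
      ; injective = λ i k → phi-injective (proj₁ (∈-units⁻ j n i)) (proj₁ (∈-units⁻ j n k))
      }

-- Power residues modulo an odd prime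

product-phi : ∀ n m L → product (map (phi n m) L) ≈ m ^ length L * product L [ n ]
product-phi n m []      = refl
product-phi n m (x ∷ L) = trans (*-≈ n (modN-idem (m * x) n) (product-phi n m L))
  (cong (λ z → modN z n) (lemma m x (m ^ length L) (product L)))
  where
  lemma : ∀ a b c d → a * b * (c * d) ≡ a * c * (b * d)
  lemma = solve-∀

coprime-product : ∀ {n} L → (∀ {x} → x ∈ L → Coprime x n) → Coprime (product L) n
coprime-product {n} []  co = 1-coprimeTo n
coprime-product (x ∷ L) co = coprime-* (co (here refl)) (coprime-product L (co ∘ there))

power-0 : ∀ n a → Power 0 n a
power-0 n a = a , cong (λ z → modN z n) (*-identityʳ a)

<-prime-coprime : ∀ {p r} → Prime p → r ≢ 0 → r < p → Coprime r p
<-prime-coprime pp r≢0 r<p = Coprime.sym (prime⇒coprime pp {{≢-nonZero r≢0}} r<p)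

nonTrivial⇒¬coprime-0 : ∀ {n} → 1 < n → ¬ Coprime 0 n
nonTrivial⇒¬coprime-0 {n} 1<n co with co (n ∣0 , ∣-refl)
... | refl = <-irrefl refl 1<n

prime>1 : ∀ {p} → Prime p → 1 < p
prime>1 {p} pp = nonTrivial⇒n>1 p {{prime⇒nonTrivial pp}}

length-units : ∀ {p} → Prime p → length (ZpowUnits p 0) ≡ p ∸ 1
length-units {p} pp =
  trans (↭-length (set⇒↭ (units-unique p 0) (unique-map⁺ suc-injective (upTo⁺ (p ∸ 1))) to from))
    (trans (length-map suc (upTo (p ∸ 1))) (length-upTo (p ∸ 1)))
  where
  instance _ = prime⇒nonZero pp
  to : ∀ {x} → x ∈ ZpowUnits p 0 → x ∈ map suc (upTo (p ∸ 1))
  to {zero}  i = let _ , co , _ = ∈-units⁻ 0 p i in ⊥-elim (nonTrivial⇒¬coprime-0 (prime>1 pp) co)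
  to {suc x} i = ∈-map⁺ suc (∈-upTo⁺ (pred-mono-≤ (proj₁ (∈-units⁻ 0 p i))))
  from : ∀ {x} → x ∈ map suc (upTo (p ∸ 1)) → x ∈ ZpowUnits p 0
  from i with ∈-map⁻ suc i
  ... | y , k , refl = ∈-units⁺ 0 p y<p (<-prime-coprime pp (λ ()) y<p) (power-0 p (suc y))
    where
    y<p : suc y < p
    y<p = subst (suc (suc y) ≤_) (suc-pred p) (s≤s (∈-upTo⁻ k))

-- Multiplication by `a` permutes the units, so their product Π satisfies a^(p-1) Π ≡ Π, and Π
-- cancels. With exponent 2^0 = 1 the list `ZpowUnits p 0` is the whole unit group.
fermat : ∀ {p a} → Prime p → Coprime a p → a ^ (p ∸ 1) ≈ 1 [ p ]
fermat {p} {a} pp co =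
  subst (λ e → a ^ e ≈ 1 [ p ]) (length-units pp) (*-cancel-≈ p Πco _ _ (begin
    modN (Π * a ^ length U) p        ≡⟨ cong (λ z → modN z p) (*-comm Π _) ⟩
    modN (a ^ length U * Π) p        ≡⟨ product-phi p a U ⟨
    modN (product (map (phi p a) U)) p
      ≡⟨ cong (λ z → modN z p) (product-↭ (permutation-↭ _≟_ (phi-units co 0 (power-0 p a)))) ⟩
    modN Π p                         ≡⟨ cong (λ z → modN z p) (*-identityʳ Π) ⟨
    modN (Π * 1) p                   ∎))
  where
  open ≡-Reasoning
  instance _ = prime⇒nonZero pp
  U : List ℕ
  U = ZpowUnits p 0
  Π : ℕ
  Π = product U
  Πco : Coprime Π p
  Πco = coprime-product U (λ i → proj₁ (proj₂ (∈-units⁻ 0 p i)))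

[-1]²≈1 : ∀ n → 1 < n → (n ∸ 1) * (n ∸ 1) ≈ 1 [ n ]
[-1]²≈1 (suc (suc t)) _ = trans (cong (λ z → modN z (suc (suc t))) (lemma t)) (∣⇒≈ (suc (suc t)) 1 (n∣m*n t))
  where
  lemma : ∀ t → suc t * suc t ≡ 1 + t * suc (suc t)
  lemma = solve-∀
[-1]²≈1 (suc zero) (s≤s ())

-- With x = y + 1, the prime divides x² - 1 = y (y + 2), hence x - 1 or x + 1; the bound x < p
-- leaves one value for each.
sqrt-1 : ∀ {p x} → Prime p → x < p → x * x ≈ 1 [ p ] → x ≡ 1 ⊎ x ≡ p ∸ 1
sqrt-1 {p} {zero} pp _ e with ≈⇒≡ p (<-trans 0<1+n (prime>1 pp)) (prime>1 pp) e
... | ()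
sqrt-1 {p} {suc y} pp x<p e
  with euclidsLemma y (2 + y) pp (≈⇒∣ p 1 (trans (cong (λ z → modN z p) (lemma y)) e))
  where
  lemma : ∀ y → 1 + y * (2 + y) ≡ suc y * suc y
  lemma = solve-∀
... | inj₁ p∣y = inj₁ (cong suc (small y (<-trans (n<1+n y) x<p) p∣y))
  where
  small : ∀ y → y < p → p ∣ y → y ≡ 0
  small zero    _   _   = refl
  small (suc y) y<p p∣y = ⊥-elim (<⇒≱ y<p (∣⇒≤ p∣y))
... | inj₂ p∣x+1 = inj₂ (cong (_∸ 1) (≤-antisym x<p (∣⇒≤ p∣x+1)))

-- For x ↦ a / x a 2-cycle contributes a and a fixed point itself. With a = 1 this is the
-- computation behind Wilson's theorem, with a nonsquare a the one behind Euler's criterion.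
orbits-product : ∀ {f : ℕ → ℕ} n a {F R L} → Orbits f F R L →
  (∀ {x} → x ∈ L → x * f x ≈ a [ n ]) → product L ≈ product F * a ^ length R [ n ]
orbits-product n a []                _   = refl
orbits-product n a (fix {x} {F} {R} _ o) eq =
  trans (*-≈ n {x} refl (orbits-product n a o (eq ∘ there)))
    (cong (λ z → modN z n) (sym (*-assoc x (product F) (a ^ length R))))
orbits-product {f} n a (flip {x} {F} {R} {L} _ _ o) eq = begin
  modN (x * (f x * product L)) n
    ≡⟨ cong (λ z → modN z n) (*-assoc x (f x) (product L)) ⟨
  modN (x * f x * product L) n
    ≡⟨ *-≈ n (eq (here refl)) (orbits-product n a o (eq ∘ there ∘ there)) ⟩
  modN (a * (product F * a ^ length R)) n
    ≡⟨ cong (λ z → modN z n) (lemma a (product F) (a ^ length R)) ⟩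
  modN (product F * (a * a ^ length R)) n ∎
  where
  open ≡-Reasoning
  lemma : ∀ a b c → a * (b * c) ≡ b * (a * c)
  lemma = solve-∀

-- a / x modulo a prime p, since x ^ (p - 2) inverts x by Fermat.
quot : (p a x : ℕ) → ℕ
quot p a x = modN (a * x ^ (p ∸ 2)) p

module OddPrime {p : ℕ} (pp : Prime p) (2<p : 2 < p) where

  private
    instance p≢0 = prime⇒nonZero pp
    1<p : 1 < p
    1<p = prime>1 pp
    pred<p : p ∸ 1 < p
    pred<p = ≤-reflexive (suc-pred p)

  coprime-[-1] : Coprime (p ∸ 1) p
  coprime-[-1] = coprime-factorˡ (p ∸ 1) (coprime-≈ p (sym ([-1]²≈1 p 1<p)) (1-coprimeTo p))

  -- The oddness of `p` enters here.
  1≢-1 : 1 ≢ p ∸ 1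
  1≢-1 e = <-irrefl (cong suc e) (subst (2 <_) (sym (suc-pred p)) 2<p)

  module _ {j a : ℕ} (co : Coprime a p) (pa : Power j p a) where

    private
      L : List ℕ
      L = ZpowUnits p j

    quot-spec : ∀ {x} → Coprime x p → x * quot p a x ≈ a [ p ]
    quot-spec {x} cx = begin
      modN (x * quot p a x) p          ≡⟨ *-≈ p {x} refl (modN-idem (a * x ^ (p ∸ 2)) p) ⟩
      modN (x * (a * x ^ (p ∸ 2))) p   ≡⟨ cong (λ z → modN z p) (lemma x a (x ^ (p ∸ 2))) ⟩
      modN (a * x ^ suc (p ∸ 2)) p     ≡⟨ cong (λ e → modN (a * x ^ e) p) (sym (+-∸-assoc 1 1<p)) ⟩
      modN (a * x ^ (p ∸ 1)) p         ≡⟨ *-≈ p {a} refl (fermat pp cx) ⟩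
      modN (a * 1) p                   ≡⟨ cong (λ z → modN z p) (*-identityʳ a) ⟩
      modN a p                         ∎
      where
      open ≡-Reasoning
      lemma : ∀ x a y → x * (a * y) ≡ a * (x * y)
      lemma = solve-∀

    quot-units : ∀ {x} → x ∈ L → quot p a x ∈ L
    quot-units {x} i = let _ , cx , px = ∈-units⁻ j p i; e = sym (modN-idem (a * x ^ (p ∸ 2)) p) in
      ∈-units⁺ j p (modN< (a * x ^ (p ∸ 2)) p)
        (coprime-≈ p e (coprime-* co (coprime-^ (p ∸ 2) cx)))
        (power-≈ j p e (power-* j p pa (power-^ j p (p ∸ 2) px)))

    quot-spec-units : ∀ {x} → x ∈ L → x * quot p a x ≈ a [ p ]
    quot-spec-units i = quot-spec (proj₁ (proj₂ (∈-units⁻ j p i)))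

    quot-involution : InvolutionOn (quot p a) L
    quot-involution = record { closed = quot-units ; involutive = involutive }
      where
      involutive : ∀ {x} → x ∈ L → quot p a (quot p a x) ≡ x
      involutive {x} i =
        let y = quot p a x
            k = quot-units i
            x<p , _ = ∈-units⁻ j p i
            _ , cy , _ = ∈-units⁻ j p k
            z<p , _ = ∈-units⁻ j p (quot-units k)
        in ≈⇒≡ p z<p x<p (*-cancel-≈ p cy _ _
             (trans (quot-spec-units k) (sym (trans (cong (λ z → modN z p) (*-comm y x)) (quot-spec-units i)))))

    quot-fixed : ∀ {x} → x ∈ L → quot p a x ≡ x → x * x ≈ a [ p ]
    quot-fixed {x} i e = trans (cong (λ y → modN (x * y) p) (sym e)) (quot-spec-units i)

    fixed-quot : ∀ {x} → x ∈ L → x * x ≈ a [ p ] → quot p a x ≡ x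
    fixed-quot {x} i e = let x<p , cx , _ = ∈-units⁻ j p i in
      ≈⇒≡ p (proj₁ (∈-units⁻ j p (quot-units i))) x<p
        (*-cancel-≈ p cx _ _ (trans (quot-spec-units i) (sym e)))

    -- A fixed point of x ↦ a / x is a square root of `a` among the 2^j-th powers, which would make
    -- `a` a 2^(j+1)-th power.
    nonsquare⇒no-fixed : ¬ Power (suc j) p a → ∀ {F R M} → L ↭ M → Orbits (quot p a) F R M → F ≡ []
    nonsquare⇒no-fixed np {[]}    q o = refl
    nonsquare⇒no-fixed np {x ∷ F} q o =
      let i , e = orbits-F o (here refl)
          k = ∈-resp-↭ (↭-sym q) i
      in ⊥-elim (np (power-suc j p (proj₂ (proj₂ (∈-units⁻ j p k))) (quot-fixed k e)))

  one-unit : ∀ j → 1 ∈ ZpowUnits p j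
  one-unit j = ∈-units⁺ j p 1<p (1-coprimeTo p) (power-1 j p)

  minus-one-unit : ∀ {j} → Power j p (p ∸ 1) → p ∸ 1 ∈ ZpowUnits p j
  minus-one-unit {j} = ∈-units⁺ j p pred<p coprime-[-1]

  inverse-involution : ∀ j → InvolutionOn (quot p 1) (ZpowUnits p j)
  inverse-involution j = quot-involution (1-coprimeTo p) (power-1 j p)

  module _ {j F R M} (q : ZpowUnits p j ↭ M) (o : Orbits (quot p 1) F R M) where

    private
      F-unique : Unique F
      F-unique = orbits-F-unique o (Unique-resp-↭ q (units-unique p j))

      F⊆ : ∀ {x} → x ∈ F → x ∈ ZpowUnits p j × (x ≡ 1 ⊎ x ≡ p ∸ 1)
      F⊆ i = let k , e = orbits-F o i
                 l = ∈-resp-↭ (↭-sym q) k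
             in l , sqrt-1 pp (proj₁ (∈-units⁻ j p l)) (quot-fixed (1-coprimeTo p) (power-1 j p) l e)

      ∈F : ∀ {x} → x ∈ ZpowUnits p j → x * x ≈ 1 [ p ] → x ∈ F
      ∈F i e = orbits-fixed o (∈-resp-↭ q i) (fixed-quot (1-coprimeTo p) (power-1 j p) i e)

    -- An element equal to its inverse squares to 1, so it is 1 or -1. The first always lies in the
    -- group; whether the second does is the distinction between this lemma and the next.
    inverse-fixed-two : Power j p (p ∸ 1) → F ↭ 1 ∷ p ∸ 1 ∷ []
    inverse-fixed-two h = set⇒↭ F-unique ((1≢-1 ∷ []) ∷ [] ∷ []) to from
      where
      to : ∀ {x} → x ∈ F → x ∈ 1 ∷ p ∸ 1 ∷ []
      to i with proj₂ (F⊆ i)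
      ... | inj₁ e = here e
      ... | inj₂ e = there (here e)
      from : ∀ {x} → x ∈ 1 ∷ p ∸ 1 ∷ [] → x ∈ F
      from (here refl)         = ∈F (one-unit j) refl
      from (there (here refl)) = ∈F (minus-one-unit h) ([-1]²≈1 p 1<p)

    inverse-fixed-one : ¬ Power j p (p ∸ 1) → F ↭ 1 ∷ []
    inverse-fixed-one h = set⇒↭ F-unique ([] ∷ []) to from
      where
      to : ∀ {x} → x ∈ F → x ∈ 1 ∷ []
      to i with F⊆ i
      ... | l , inj₁ e    = here e
      ... | l , inj₂ refl = ⊥-elim (h (proj₂ (proj₂ (∈-units⁻ j p l))))
      from : ∀ {x} → x ∈ 1 ∷ [] → x ∈ F
      from (here refl) = ∈F (one-unit j) refl

  -- Modulo 2 the 2-cycles of inversion drop out of the length, and only its one or two fixed points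
  -- are counted.
  odd-units : ∀ j → odd (length (ZpowUnits p j)) ≡ not (does (power? j p (p ∸ 1)))
  odd-units j with orbits _≟_ (units-unique p j) (inverse-involution j)
  ... | F , R , M , q , o
      rewrite ↭-length q | orbits-length o | odd-+ (length F) (length R + length R)
            | odd-double (length R) | xor-identityʳ (odd (length F))
      with power? j p (p ∸ 1)
  ... | yes h rewrite ↭-length (inverse-fixed-two q o h) = cong not (sym (dec-true (power? j p (p ∸ 1)) h))
  ... | no  h rewrite ↭-length (inverse-fixed-one q o h) = cong not (sym (dec-false (power? j p (p ∸ 1)) h))

  nonsquare⇒power-[-1] : ∀ {j m} → Coprime m p → Power j p m → ¬ Power (suc j) p m → Power j p (p ∸ 1)
  nonsquare⇒power-[-1] {j} co pm np
      with power? j p (p ∸ 1) | orbits _≟_ (units-unique p j) (quot-involution co pm)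
  ... | yes h | _ = h
  ... | no  h | F , R , M , q , o
      with refl ← nonsquare⇒no-fixed co pm np q o
      -- Without -1 the count by inversion is odd, while the fixed-point-free x ↦ m / x makes the
      -- same length even.
      with () ← trans (sym (trans (odd-units j) (cong not (dec-false (power? j p (p ∸ 1)) h))))
                  (trans (cong odd (trans (↭-length q) (orbits-length o))) (odd-double (length R)))

  module _ {c : ℕ → ℕ → Bool} (C : Tournament c) {j m : ℕ} (co : Coprime m p) (pm : Power j p m) where

    private
      L : List ℕ
      L = ZpowUnits p j

    -- The square root `u = x ^ (2 ^ j)` of `m` is itself a 2^j-th power, so multiplication by `m`
    -- is the square of a permutation of the same list.
    parity-square : Power (suc j) p m → parity c (phi p m) L ≡ false
    parity-square (x , e) = begin
      parity c (phi p m) L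
        ≡⟨ parity-cong c L (λ {y} _ → eq y) ⟩
      parity c (phi p u ∘ phi p u) L
        ≡⟨ parity-∘ _≟_ C (permutation-↭ _≟_ (phi-units cu j pu)) (PermutationOn.injective (phi-units cu j pu)) ⟩
      parity c (phi p u) L xor parity c (phi p u) L
        ≡⟨ xor-same (parity c (phi p u) L) ⟩
      false ∎
      where
      open ≡-Reasoning
      u : ℕ
      u = x ^ (2 ^ j)
      pu : Power j p u
      pu = x , refl
      cu : Coprime u p
      cu = coprime-^ (2 ^ j) (power-base-coprime (suc j) p x e co)
      eq : ∀ y → phi p m y ≡ phi p u (phi p u y)
      eq y = begin
        modN (m * y) p       ≡⟨ *-≈ p {m} {u * u} (trans (sym e) (cong (λ z → modN z p) (^-2^suc x j))) refl ⟩
        modN (u * u * y) p   ≡⟨ cong (λ z → modN z p) (*-assoc u u y) ⟩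
        modN (u * (u * y)) p ≡⟨ *-≈ p {u} refl (modN-idem (u * y) p) ⟨
        modN (u * modN (u * y) p) p ∎

    parity-nonsquare : ¬ Power (suc j) p m → parity c (phi p m) L ≡ true
    parity-nonsquare np with orbits _≟_ (units-unique p j) (quot-involution co pm)
                           | orbits _≟_ (units-unique p j) (inverse-involution j)
    ... | F , R , M , q , o | F′ , R′ , M′ , q′ , o′
        with refl ← nonsquare⇒no-fixed co pm np q o = begin
      parity c (phi p m) L
        ≡⟨ xor-cancelˡ (parity c (quot p 1) L) _ ⟨
      parity c (quot p 1) L xor (parity c (quot p 1) L xor parity c (phi p m) L)
        ≡⟨ cong (parity c (quot p 1) L xor_) (parity-∘ _≟_ C
             (permutation-↭ _≟_ record
               { unique    = units-unique p j
               ; closed    = InvolutionOn.closed ι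
               ; injective = InvolutionOn.injective ι
               })
             (PermutationOn.injective (phi-units co j pm))) ⟨
      parity c (quot p 1) L xor parity c (phi p m ∘ quot p 1) L
        ≡⟨ cong (parity c (quot p 1) L xor_) (parity-cong c L (λ {x} _ → φι x)) ⟩
      parity c (quot p 1) L xor parity c (quot p m) L
        ≡⟨ cong₂ _xor_ (cycles (inverse-involution j) q′ o′) (cycles (quot-involution co pm) q o) ⟩
      odd (length R′) xor odd (length R)
        ≡⟨ cong (odd (length R′) xor_) (cong odd R≡) ⟩
      odd (length R′) xor not (odd (length R′))
        ≡⟨ xor-not (odd (length R′)) ⟩
      true ∎
      where
      open ≡-Reasoning
      ι = inverse-involution j
      φι : ∀ x → phi p m (quot p 1 x) ≡ quot p m x
      φι x = trans (*-≈ p {m} refl (modN-idem (1 * x ^ (p ∸ 2)) p))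
        (cong (λ z → modN (m * z) p) (*-identityˡ (x ^ (p ∸ 2))))
      cycles : ∀ {f F R M} → InvolutionOn f L → L ↭ M → Orbits f F R M → parity c f L ≡ odd (length R)
      cycles inv q o = trans (parity-↭ _≟_ C (InvolutionOn.injective inv) q) (orbits-parity C o)
      xor-not : ∀ b → b xor not b ≡ true
      xor-not true  = refl
      xor-not false = refl
      |L| : length L ≡ length R + length R
      |L| = trans (↭-length q) (orbits-length o)
      -- The two involutions count the same list: 2 |R| = 2 + 2 |R′|, where the summand 2 stands for
      -- the fixed points 1 and -1 of inversion.
      R≡ : length R ≡ suc (length R′)
      R≡ = double-injective (trans (sym |L|) (trans (↭-length q′) (trans (orbits-length o′)
             (trans (cong (_+ (length R′ + length R′)) (↭-length (inverse-fixed-two q′ o′ (nonsquare⇒power-[-1] co pm np))))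
               (cong suc (sym (+-suc (length R′) (length R′))))))))
        where
        double-injective : ∀ {a b} → a + a ≡ b + b → a ≡ b
        double-injective {zero}  {zero}  _ = refl
        double-injective {suc a} {suc b} e = cong suc (double-injective
          (suc-injective (trans (sym (+-suc a a)) (trans (suc-injective e) (+-suc b b)))))

    parity-units : parity c (phi p m) L ≡ not (does (power? (suc j) p m))
    parity-units with power? (suc j) p m
    ... | yes h = trans (parity-square h) (cong not (sym (dec-true (power? (suc j) p m) h)))
    ... | no  h = trans (parity-nonsquare h) (cong not (sym (dec-false (power? (suc j) p m) h)))

  -- When -1 is a 2^j-th power modulo p

  nonresidue : ∃ λ g → Coprime g p × ¬ Power 1 p g
  nonresidue with any? (λ r → ¬? (power? 1 p r)) (ZpowUnits p 0)
  ... | yes a = let g , i , np = find a in g , proj₁ (proj₂ (∈-units⁻ 0 p i)) , np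
  ... | no ¬a with ∈⇒↭∷ (minus-one-unit (power-0 p (p ∸ 1)))
  ... | L′ , q = ⊥-elim (1+n≰n (subst (suc (length L′) ≤_) (length-map (λ x → modN (x * x) p) L′)
          (subst (_≤ length (map (λ x → modN (x * x) p) L′)) (↭-length q)
            (unique-⊆⇒length≤ (units-unique p 0) sub))))
    where
    1∈L′ : 1 ∈ L′
    1∈L′ with ∈-resp-↭ q (one-unit 0)
    ... | here e  = ⊥-elim (1≢-1 e)
    ... | there i = i
    -- 1 and -1 have the same square, so the squares of L′ already exhaust the squares.
    sub : ∀ {r} → r ∈ ZpowUnits p 0 → r ∈ map (λ x → modN (x * x) p) L′
    sub {r} i with decidable-stable (power? 1 p r) (λ np → ¬a (lose i np))
    ... | x , e with ∈-resp-↭ q y∈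
      where
      y∈ : modN x p ∈ ZpowUnits p 0
      y∈ = ∈-units⁺ 0 p (modN< x p)
        (coprime-≈ p (sym (modN-idem x p)) (power-base-coprime 1 p x e (proj₁ (proj₂ (∈-units⁻ 0 p i)))))
        (power-0 p (modN x p))
    ... | there k = subst (_∈ map (λ x → modN (x * x) p) L′) eq (∈-map⁺ _ k)
      where
      eq : modN (modN x p * modN x p) p ≡ r
      eq = trans (*-≈ p (modN-idem x p) (modN-idem x p))
        (trans (cong (λ z → modN (x * z) p) (sym (*-identityʳ x))) (trans e (modN-small (proj₁ (∈-units⁻ 0 p i)))))
    ... | here h = subst (_∈ map (λ x → modN (x * x) p) L′) eq (∈-map⁺ _ 1∈L′)
      where
      eq : modN (1 * 1) p ≡ r
      eq = begin
        modN 1 p                        ≡⟨ [-1]²≈1 p 1<p ⟨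
        modN ((p ∸ 1) * (p ∸ 1)) p      ≡⟨ cong (λ z → modN (z * z) p) h ⟨
        modN (modN x p * modN x p) p    ≡⟨ *-≈ p (modN-idem x p) (modN-idem x p) ⟩
        modN (x * x) p                  ≡⟨ cong (λ z → modN (x * z) p) (*-identityʳ x) ⟨
        modN (x ^ 2) p                  ≡⟨ e ⟩
        modN r p                        ≡⟨ modN-small (proj₁ (∈-units⁻ 0 p i)) ⟩
        r                               ∎
        where open ≡-Reasoning

  -- Pairing x with g/x and with 1/x evaluates the product of all units as
  -- g ^ ((p - 1) / 2) and as -1 respectively.
  euler-nonresidue : ∃ λ g → ∃ λ s → p ∸ 1 ≡ s + s × g ^ s ≈ p ∸ 1 [ p ]
  euler-nonresidue with nonresidue
  ... | g , cg , ng
      with orbits _≟_ (units-unique p 0) (quot-involution cg (power-0 p g))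
         | orbits _≟_ (units-unique p 0) (inverse-involution 0)
  ... | F , R , M , q , o | F′ , R′ , M′ , q′ , o′
      with refl ← nonsquare⇒no-fixed cg (power-0 p g) ng q o =
    g , length R , trans (sym (length-units pp)) (trans (↭-length q) (orbits-length o)) , (begin
      modN (g ^ length R) p
        ≡⟨ cong (λ z → modN z p) (*-identityˡ (g ^ length R)) ⟨
      modN (1 * g ^ length R) p
        ≡⟨ orbits-product p g o (λ i → quot-spec-units cg (power-0 p g) (∈-resp-↭ (↭-sym q) i)) ⟨
      modN (product M) p
        ≡⟨ cong (λ z → modN z p) (product-↭ (↭-trans (↭-sym q) q′)) ⟩
      modN (product M′) p
        ≡⟨ orbits-product p 1 o′ (λ i → quot-spec-units (1-coprimeTo p) (power-1 0 p) (∈-resp-↭ (↭-sym q′) i)) ⟩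
      modN (product F′ * 1 ^ length R′) p
        ≡⟨ cong₂ (λ y z → modN (y * z) p) (product-↭ (inverse-fixed-two q′ o′ (power-0 p (p ∸ 1)))) (^-zeroˡ (length R′)) ⟩
      modN (1 * ((p ∸ 1) * 1) * 1) p
        ≡⟨ cong (λ z → modN z p) (lemma (p ∸ 1)) ⟩
      modN (p ∸ 1) p ∎)
    where
    open ≡-Reasoning
    lemma : ∀ a → 1 * (a * 1) * 1 ≡ a
    lemma = solve-∀

  -- Here s = (p - 1) / 2 = d 2^j, so g^s ≡ -1 exhibits g^d as a 2^j-th root of -1.
  ∣⇒power-[-1] : ∀ j → 2 ^ suc j ∣ p ∸ 1 → Power j p (p ∸ 1)
  ∣⇒power-[-1] j (divides d e) with euler-nonresidue
  ... | g , s , 2s , h = g ^ d , trans (cong (λ z → modN z p) (trans (^-*-assoc g d (2 ^ j)) (cong (g ^_) (sym s≡)))) h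
    where
    s≡ : s ≡ d * 2 ^ j
    s≡ = *-cancelˡ-≡ s (d * 2 ^ j) 2 (trans (cong (s +_) (+-identityʳ s)) (trans (sym 2s) (trans e (lemma d (2 ^ j)))))
      where
      lemma : ∀ d x → d * (2 * x) ≡ 2 * (d * x)
      lemma = solve-∀

  -- Suppose p - 1 = w 2^i with w odd and i ≤ j. The w-th power of z^(2^j) ≡ -1 is -1 as w is odd,
  -- yet 1 by Fermat, since 2^j w is the multiple (p - 1) 2^(j-i). Hence `w` is even, and one more
  -- factor 2 is gained until i = j + 1.
  power-[-1]⇒∣ : ∀ j → Power j p (p ∸ 1) → 2 ^ suc j ∣ p ∸ 1
  power-[-1]⇒∣ j (z , h) = go (suc j) ≤-refl
    where
    open ≡-Reasoning
    cz : Coprime z p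
    cz = power-base-coprime j p z h coprime-[-1]
    go : ∀ i → i ≤ suc j → 2 ^ i ∣ p ∸ 1
    go zero    _         = 1∣ (p ∸ 1)
    go (suc i) (s≤s i≤j) with go i (m≤n⇒m≤1+n i≤j)
    ... | divides d e with half d
    ...   | b , inj₁ refl = divides b (trans e (lemma b (2 ^ i)))
      where
      lemma : ∀ b x → (b + b) * x ≡ b * (2 * x)
      lemma = solve-∀
    ...   | b , inj₂ refl = ⊥-elim (1≢-1 (≈⇒≡ p 1<p pred<p (trans (sym z^≈1) z^≈-1)))
      where
      w : ℕ
      w = suc (b + b)
      z^≈-1 : (z ^ (2 ^ j)) ^ w ≈ p ∸ 1 [ p ]
      z^≈-1 = begin
        modN ((z ^ (2 ^ j)) ^ w) p                     ≡⟨ ^-≈ p w h ⟩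
        modN ((p ∸ 1) * (p ∸ 1) ^ (b + b)) p           ≡⟨ cong (λ y → modN ((p ∸ 1) * y) p) (trans (^-distribˡ-+-* (p ∸ 1) b b) (sym (^-distribʳ-* (p ∸ 1) (p ∸ 1) b))) ⟩
        modN ((p ∸ 1) * ((p ∸ 1) * (p ∸ 1)) ^ b) p     ≡⟨ *-≈ p {p ∸ 1} refl (^-≈ p b ([-1]²≈1 p 1<p)) ⟩
        modN ((p ∸ 1) * 1 ^ b) p                       ≡⟨ cong (λ y → modN ((p ∸ 1) * y) p) (^-zeroˡ b) ⟩
        modN ((p ∸ 1) * 1) p                           ≡⟨ cong (λ y → modN y p) (*-identityʳ (p ∸ 1)) ⟩
        modN (p ∸ 1) p                                 ∎
      2^j : 2 ^ j ≡ 2 ^ i * 2 ^ (j ∸ i)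
      2^j = trans (cong (2 ^_) (sym (m+[n∸m]≡n i≤j))) (^-distribˡ-+-* 2 i (j ∸ i))
      exponent : 2 ^ j * w ≡ (p ∸ 1) * 2 ^ (j ∸ i)
      exponent = trans (cong (_* w) 2^j) (trans (lemma (2 ^ i) (2 ^ (j ∸ i)) w) (cong (_* 2 ^ (j ∸ i)) (sym e)))
        where
        lemma : ∀ x y w → x * y * w ≡ w * x * y
        lemma = solve-∀
      z^≈1 : (z ^ (2 ^ j)) ^ w ≈ 1 [ p ]
      z^≈1 = begin
        modN ((z ^ (2 ^ j)) ^ w) p             ≡⟨ cong (λ y → modN y p) (trans (^-*-assoc z (2 ^ j) w) (trans (cong (z ^_) exponent) (sym (^-*-assoc z (p ∸ 1) (2 ^ (j ∸ i)))))) ⟩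
        modN ((z ^ (p ∸ 1)) ^ 2 ^ (j ∸ i)) p   ≡⟨ ^-≈ p (2 ^ (j ∸ i)) (fermat pp cz) ⟩
        modN (1 ^ 2 ^ (j ∸ i)) p               ≡⟨ cong (λ y → modN y p) (^-zeroˡ (2 ^ (j ∸ i))) ⟩
        modN 1 p                               ∎

-- The product of two primes

<-tournament : Tournament _<ᵇ_
<-tournament {x} {y} x≢y with <-cmp x y
... | tri< a _ c = trans (dec-true (x <? y) a) (cong not (sym (dec-false (y <? x) c)))
... | tri≈ _ b _ = ⊥-elim (x≢y b)
... | tri> a _ c = trans (dec-false (x <? y) a) (cong not (sym (dec-true (y <? x) c)))

-- The reference tournament once residues modulo N are replaced by pairs of residues.
lex : ℕ × ℕ → ℕ × ℕ → Bool
lex (a , b) (a′ , b′) = if does (a ≟ a′) then b <ᵇ b′ else a <ᵇ a′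

lex-tournament : Tournament lex
lex-tournament {a , b} {a′ , b′} ≢ with a ≟ a′
... | yes refl rewrite dec-true (a ≟ a) refl = <-tournament (≢ ∘ cong (a ,_))
... | no  a≢a′ rewrite dec-false (a ≟ a′) a≢a′ | dec-false (a′ ≟ a) (a≢a′ ∘ sym) = <-tournament a≢a′

-- Signs, inversions and permutations of a product set

sign : Bool → ℤ
sign false = 1ℤ
sign true  = -1ℤ

sign-xor : ∀ a b → sign (a xor b) ≡ sign a *ℤ sign b
sign-xor false b     = sym (ℤ.*-identityˡ (sign b))
sign-xor true  false = refl
sign-xor true  true  = refl

-1^ : ∀ n → -1ℤ ^ℤ n ≡ sign (odd n)
-1^ zero    = refl
-1^ (suc n) = trans (cong (-1ℤ *ℤ_) (-1^ n)) (sym (sign-xor true (odd n)))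

-- In a sorted list `x <ᵇ y` is true for `x` before `y`, so the term of `parity` is the negation of
-- `f x <ᵇ f y`. As `f x` and `f y` differ, that marks an inversion.
odd-inversions : ∀ {f S} → AllPairs _<_ S → InjectiveOn f S → odd (inversions f S) ≡ parity _<ᵇ_ f S
odd-inversions []      inj = refl
odd-inversions {f} {x ∷ S} (x< ∷ s) inj =
  trans (odd-+ (length (filter (λ y → f y <? f x) S)) (inversions f S))
    (cong₂ _xor_
      (trans (count S)
        (⨁-cong S (λ {y} i → sym (trans
          (cong (_xor (f x <ᵇ f y)) (dec-true (x <? y) (All.lookup x< i)))
          (sym (<-tournament (λ e → <-irrefl (inj (here refl) (there i) (sym e)) (All.lookup x< i))))))))
      (odd-inversions s (λ i j → inj (there i) (there j))))
  where
  count : ∀ S → odd (length (filter (λ y → f y <? f x) S)) ≡ ⨁ (λ y → f y <ᵇ f x) S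
  count []      = refl
  count (y ∷ S) with f y <ᵇ f x
  ... | true  = cong not (count S)
  ... | false = count S

sgn-parity : ∀ {f S} → AllPairs _<_ S → InjectiveOn f S → sgn f S ≡ sign (parity _<ᵇ_ f S)
sgn-parity {f} {S} s inj = trans (-1^ (inversions f S)) (cong sign (odd-inversions s inj))

upTo-sorted : ∀ n → AllPairs _<_ (upTo n)
upTo-sorted n = AllPairs.applyUpTo⁺₁ id n (λ i<j _ → i<j)

swap-cartesianProduct : ∀ {X Y : List ℕ} → Unique X → Unique Y →
  cartesianProduct X Y ↭ map ×-swap (cartesianProduct Y X)
swap-cartesianProduct {X} {Y} u v =
  set⇒↭ (cartesianProduct⁺ u v)
    (unique-map⁺ (λ { refl → refl }) (cartesianProduct⁺ v u)) to from
  where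
  to : ∀ {z} → z ∈ cartesianProduct X Y → z ∈ map ×-swap (cartesianProduct Y X)
  to i = let j , k = ∈-cartesianProduct⁻ X Y i in ∈-map⁺ ×-swap (∈-cartesianProduct⁺ k j)
  from : ∀ {z} → z ∈ map ×-swap (cartesianProduct Y X) → z ∈ cartesianProduct X Y
  from i with ∈-map⁻ ×-swap i
  ... | _ , l , refl = let k , j = ∈-cartesianProduct⁻ Y X l in ∈-cartesianProduct⁺ j k

_≟²_ : DecidableEquality (ℕ × ℕ)
_≟²_ = ≡-dec _≟_ _≟_

permutation-id : ∀ {X : List ℕ} → Unique X → PermutationOn id X
permutation-id u = record { unique = u ; closed = id ; injective = λ _ _ → id }

permutation-× : ∀ {f g : ℕ → ℕ} {X Y} → PermutationOn f X → PermutationOn g Y →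
  PermutationOn (f ×′ g) (cartesianProduct X Y)
permutation-× {f} {g} {X} {Y} F G = record
  { unique    = cartesianProduct⁺ (F .unique) (G .unique)
  ; closed    = λ i → let i₁ , i₂ = ∈-cartesianProduct⁻ X Y i in
      ∈-cartesianProduct⁺ (F .closed i₁) (G .closed i₂)
  ; injective = λ i j e →
      let i₁ , i₂ = ∈-cartesianProduct⁻ X Y i; j₁ , j₂ = ∈-cartesianProduct⁻ X Y j in
      cong₂ _,_ (F .injective i₁ j₁ (cong proj₁ e)) (G .injective i₂ j₂ (cong proj₂ e))
  }
  where open PermutationOn

module _ {c : ℕ × ℕ → ℕ × ℕ → Bool} {d : ℕ → ℕ → Bool} (T : Tournament c) (T′ : Tournament d) where

  -- Each row {x} × Y is stable and carries a copy of `g`, so the parity of `g` is added |X| times.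
  parity-id× : ∀ {g X Y} → Unique X → PermutationOn g Y →
    parity c (id ×′ g) (cartesianProduct X Y) ≡ odd (length X) ∧ parity d g Y
  parity-id×         {Y = Y} []              G = refl
  parity-id× {g} {x ∷ X} {Y} (_ ∷ u) G = begin
    parity c (id ×′ g) (map (x ,_) Y ++ cartesianProduct X Y)
      ≡⟨ parity-++ c (id ×′ g) (map (x ,_) Y) (cartesianProduct X Y)
           -- `(id ×′ g) ∘ (x ,_)` and `(x ,_) ∘ g` agree definitionally, hence `map-∘` read in both
           -- directions.
           (↭-trans (↭-reflexive (trans (sym (map-∘ Y)) (map-∘ Y))) (↭-map⁺ (x ,_) G↭))
           (permutation-↭ _≟²_ (permutation-× (permutation-id u) G)) ⟩
    parity c (id ×′ g) (map (x ,_) Y) xor parity c (id ×′ g) (cartesianProduct X Y)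
      ≡⟨ cong₂ _xor_ (trans (parity-map c (x ,_) Y (λ _ → refl))
           (sym (parity-tournament _≟_ (x ,_) T′ T (λ { _ _ refl → refl }) G↭))) (parity-id× u G) ⟩
    parity d g Y xor (odd (length X) ∧ parity d g Y)
      ≡⟨ xor-∧ (parity d g Y) (odd (length X)) ⟩
    not (odd (length X)) ∧ parity d g Y ∎
    where
    open ≡-Reasoning
    G↭ : map g Y ↭ Y
    G↭ = permutation-↭ _≟_ G
    xor-∧ : ∀ a b → a xor (b ∧ a) ≡ not b ∧ a
    xor-∧ true  true  = refl
    xor-∧ true  false = refl
    xor-∧ false true  = refl
    xor-∧ false false = refl

-- The map splits into `f ×′ id` followed by `id ×′ g`. Swapping coordinates brings the former to
-- the row case, with the tournament pulled back along the swap.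
parity-× : ∀ {c : ℕ × ℕ → ℕ × ℕ → Bool} {d : ℕ → ℕ → Bool} {f g X Y} →
  Tournament c → Tournament d → PermutationOn f X → PermutationOn g Y →
  parity c (f ×′ g) (cartesianProduct X Y) ≡
    (odd (length Y) ∧ parity d f X) xor (odd (length X) ∧ parity d g Y)
parity-× {c} {d} {f} {g} {X} {Y} T T′ F G = begin
  parity c (f ×′ g) XY
    ≡⟨ parity-∘ _≟²_ {f = f ×′ id} {g = id ×′ g} T (permutation-↭ _≟²_ f×id) (PermutationOn.injective id×g) ⟩
  parity c (f ×′ id) XY xor parity c (id ×′ g) XY
    ≡⟨ cong₂ _xor_ first (parity-id× T T′ (PermutationOn.unique F) G) ⟩
  (odd (length Y) ∧ parity d f X) xor (odd (length X) ∧ parity d g Y) ∎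
  where
  open ≡-Reasoning
  XY : List (ℕ × ℕ)
  XY = cartesianProduct X Y
  f×id : PermutationOn (f ×′ id) XY
  f×id = permutation-× F (permutation-id (PermutationOn.unique G))
  id×g : PermutationOn (id ×′ g) XY
  id×g = permutation-× (permutation-id (PermutationOn.unique F)) G
  first : parity c (f ×′ id) XY ≡ odd (length Y) ∧ parity d f X
  first = begin
    parity c (f ×′ id) XY
      ≡⟨ parity-↭ _≟²_ T (PermutationOn.injective f×id)
           (swap-cartesianProduct (PermutationOn.unique F) (PermutationOn.unique G)) ⟩
    parity c (f ×′ id) (map ×-swap (cartesianProduct Y X))
      ≡⟨ parity-map c ×-swap (cartesianProduct Y X) (λ _ → refl) ⟩
    parity (λ x y → c (×-swap x) (×-swap y)) (id ×′ f) (cartesianProduct Y X)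
      ≡⟨ parity-id× (λ x≢y → T (x≢y ∘ cong ×-swap)) T′ (PermutationOn.unique G) F ⟩
    odd (length Y) ∧ parity d f X ∎

-- The Chinese remainder theorem and its effect on signs

≈-∣ : ∀ {n d} a b → d ∣ n → a ≈ b [ n ] → a ≈ b [ d ]
≈-∣ {n} {d} a b d∣n e = ∣-∣⇒≈ d a b (∣-trans d∣n (≈⇒∣-∣ n a b e))

module CRT {p q : ℕ} (pp : Prime p) (pq : Prime q) (p⊥q : Coprime p q) where

  private
    N : ℕ
    N = p * q
    instance
      p≢0 = prime⇒nonZero pp
      q≢0 = prime⇒nonZero pq
      N≢0 = m*n≢0 p q
    p∣N : p ∣ N
    p∣N = m∣m*n q
    q∣N : q ∣ N
    q∣N = n∣m*n p

  ≈-crt : ∀ a b → a ≈ b [ p ] → a ≈ b [ q ] → a ≈ b [ N ]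
  ≈-crt a b e e′ with ≈⇒∣-∣ p a b e | ≈⇒∣-∣ q a b e′
  ... | divides k ≡kp | q∣ = ∣-∣⇒≈ N a b (subst (N ∣_) (sym (trans ≡kp (*-comm k p)))
          (*-monoʳ-∣ p (coprime-divisor (Coprime.sym p⊥q) (subst (q ∣_) (trans ≡kp (*-comm k p)) q∣))))

  -- By Fermat, q ^ (p - 1) is 1 modulo p and 0 modulo q.
  crt : ℕ → ℕ → ℕ
  crt a b = a * q ^ (p ∸ 1) + b * p ^ (q ∸ 1)

  ∣^pred : ∀ {r s} → Prime s → r ∣ r ^ (s ∸ 1)
  ∣^pred {r} {zero}        ps = ⊥-elim (<⇒≱ (prime>1 ps) z≤n)
  ∣^pred {r} {suc zero}    ps = ⊥-elim (<-irrefl refl (prime>1 ps))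
  ∣^pred {r} {suc (suc s)} ps = m∣m*n (r ^ s)

  crt-p : ∀ a b → crt a b ≈ a [ p ]
  crt-p a b = trans (∣⇒≈ p (a * q ^ (p ∸ 1)) (∣n⇒∣m*n b (∣^pred pq)))
    (trans (*-≈ p {a} refl (fermat pp (Coprime.sym p⊥q))) (cong (λ z → modN z p) (*-identityʳ a)))

  crt-q : ∀ a b → crt a b ≈ b [ q ]
  crt-q a b = trans (cong (λ z → modN z q) (+-comm (a * q ^ (p ∸ 1)) _))
    (trans (∣⇒≈ q (b * p ^ (q ∸ 1)) (∣n⇒∣m*n a (∣^pred pp)))
      (trans (*-≈ q {b} refl (fermat pq p⊥q)) (cong (λ z → modN z q) (*-identityʳ b))))

  residues : ℕ → ℕ × ℕ
  residues r = modN r p , modN r q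

  residues-injective : ∀ {r s} → r < N → s < N → residues r ≡ residues s → r ≡ s
  residues-injective {r} {s} r<N s<N e = ≈⇒≡ N r<N s<N (≈-crt r s (cong proj₁ e) (cong proj₂ e))

  residues-phi : ∀ m r → (phi p m ×′ phi q m) (residues r) ≡ residues (phi N m r)
  residues-phi m r = cong₂ _,_
    (trans (*-≈ p {m} refl (modN-idem r p)) (≈-∣ (m * r) _ p∣N (sym (modN-idem (m * r) N))))
    (trans (*-≈ q {m} refl (modN-idem r q)) (≈-∣ (m * r) _ q∣N (sym (modN-idem (m * r) N))))

  power-crt : ∀ j {a} → Power j p a → Power j q a → Power j N a
  power-crt j {a} (x , e) (y , e′) = crt x y ,
    ≈-crt (crt x y ^ (2 ^ j)) a (trans (^-≈ p (2 ^ j) (crt-p x y)) e) (trans (^-≈ q (2 ^ j) (crt-q x y)) e′)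

  power-p : ∀ j {a} → Power j N a → Power j p a
  power-p j {a} (x , e) = x , ≈-∣ (x ^ (2 ^ j)) a p∣N e

  power-q : ∀ j {a} → Power j N a → Power j q a
  power-q j {a} (x , e) = x , ≈-∣ (x ^ (2 ^ j)) a q∣N e

  coprime-p : ∀ {a} → Coprime a N → Coprime a p
  coprime-p co (d∣a , d∣p) = co (d∣a , ∣-trans d∣p p∣N)

  coprime-q : ∀ {a} → Coprime a N → Coprime a q
  coprime-q co (d∣a , d∣q) = co (d∣a , ∣-trans d∣q q∣N)

  coprime-crt : ∀ {a} → Coprime a p → Coprime a q → Coprime a N
  coprime-crt cp cq = Coprime.sym (coprime-* (Coprime.sym cp) (Coprime.sym cq))

  crt-residues : ∀ {a b} → a < p → b < q → residues (modN (crt a b) N) ≡ (a , b)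
  crt-residues {a} {b} a<p b<q = cong₂ _,_
    (trans (≈-∣ (modN (crt a b) N) (crt a b) p∣N (modN-idem (crt a b) N)) (trans (crt-p a b) (modN-small a<p)))
    (trans (≈-∣ (modN (crt a b) N) (crt a b) q∣N (modN-idem (crt a b) N)) (trans (crt-q a b) (modN-small b<q)))

  Zpow-residues : ∀ j → map residues (Zpow N j) ↭ cartesianProduct (Zpow p j) (Zpow q j)
  Zpow-residues j = set⇒↭
    (unique-map (Zpow-unique N j) (λ i k → residues-injective (proj₁ (∈-Zpow⁻ j N i)) (proj₁ (∈-Zpow⁻ j N k))))
    (cartesianProduct⁺ (Zpow-unique p j) (Zpow-unique q j)) to from
    where
    to : ∀ {z} → z ∈ map residues (Zpow N j) → z ∈ cartesianProduct (Zpow p j) (Zpow q j)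
    to i with ∈-map⁻ residues i
    ... | r , k , refl = let _ , w = ∈-Zpow⁻ j N k in ∈-cartesianProduct⁺
      (∈-Zpow⁺ j p (modN< r p) (power-≈ j p (sym (modN-idem r p)) (power-p j w)))
      (∈-Zpow⁺ j q (modN< r q) (power-≈ j q (sym (modN-idem r q)) (power-q j w)))
    from : ∀ {z} → z ∈ cartesianProduct (Zpow p j) (Zpow q j) → z ∈ map residues (Zpow N j)
    from {a , b} i =
      let i₁ , i₂ = ∈-cartesianProduct⁻ (Zpow p j) (Zpow q j) i
          a<p , u = ∈-Zpow⁻ j p i₁
          b<q , v = ∈-Zpow⁻ j q i₂
      in subst (_∈ map residues (Zpow N j)) (crt-residues a<p b<q) (∈-map⁺ residues
           (∈-Zpow⁺ j N (modN< (crt a b) N) (power-≈ j N (sym (modN-idem (crt a b) N))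
             (power-crt j (power-≈ j p (sym (crt-p a b)) u) (power-≈ j q (sym (crt-q a b)) v)))))

  units-residues : ∀ j → map residues (ZpowUnits N j) ↭ cartesianProduct (ZpowUnits p j) (ZpowUnits q j)
  units-residues j = set⇒↭
    (unique-map (units-unique N j) (λ i k → residues-injective (proj₁ (∈-units⁻ j N i)) (proj₁ (∈-units⁻ j N k))))
    (cartesianProduct⁺ (units-unique p j) (units-unique q j)) to from
    where
    to : ∀ {z} → z ∈ map residues (ZpowUnits N j) → z ∈ cartesianProduct (ZpowUnits p j) (ZpowUnits q j)
    to i with ∈-map⁻ residues i
    ... | r , k , refl = let _ , c , w = ∈-units⁻ j N k in ∈-cartesianProduct⁺
      (∈-units⁺ j p (modN< r p) (coprime-≈ p (sym (modN-idem r p)) (coprime-p c)) (power-≈ j p (sym (modN-idem r p)) (power-p j w)))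
      (∈-units⁺ j q (modN< r q) (coprime-≈ q (sym (modN-idem r q)) (coprime-q c)) (power-≈ j q (sym (modN-idem r q)) (power-q j w)))
    from : ∀ {z} → z ∈ cartesianProduct (ZpowUnits p j) (ZpowUnits q j) → z ∈ map residues (ZpowUnits N j)
    from {a , b} i =
      let i₁ , i₂ = ∈-cartesianProduct⁻ (ZpowUnits p j) (ZpowUnits q j) i
          a<p , c , u = ∈-units⁻ j p i₁
          b<q , d , v = ∈-units⁻ j q i₂
          e = sym (modN-idem (crt a b) N)
      in subst (_∈ map residues (ZpowUnits N j)) (crt-residues a<p b<q) (∈-map⁺ residues
           (∈-units⁺ j N (modN< (crt a b) N)
             (coprime-≈ N e (coprime-crt (coprime-≈ p (sym (crt-p a b)) c) (coprime-≈ q (sym (crt-q a b)) d)))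
             (power-≈ j N e (power-crt j (power-≈ j p (sym (crt-p a b)) u) (power-≈ j q (sym (crt-q a b)) v)))))

  -- `residues` is not monotone, so `_<ᵇ_` is exchanged for the pullback of `lex` before the
  -- permutation is transported. The order in which the pairs are then listed no longer matters.
  sgn-residues : ∀ {m S X Y} → AllPairs _<_ S → (∀ {r} → r ∈ S → r < N) →
    PermutationOn (phi N m) S → PermutationOn (phi p m) X → PermutationOn (phi q m) Y →
    map residues S ↭ cartesianProduct X Y →
    sgn (phi N m) S ≡
      sign ((odd (length Y) ∧ parity _<ᵇ_ (phi p m) X) xor (odd (length X) ∧ parity _<ᵇ_ (phi q m) Y))
  sgn-residues {m} {S} {X} {Y} sorted S<N Φ Φp Φq e↭ =
    trans (sgn-parity sorted (PermutationOn.injective Φ)) (cong sign (begin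
      parity _<ᵇ_ (phi N m) S
        ≡⟨ parity-tournament _≟_ residues <-tournament lex-tournament
             (λ i j → residues-injective (S<N i) (S<N j)) (permutation-↭ _≟_ Φ) ⟩
      parity (λ x y → lex (residues x) (residues y)) (phi N m) S
        ≡⟨ parity-map lex {f = phi p m ×′ phi q m} residues S (λ {r} _ → residues-phi m r) ⟨
      parity lex (phi p m ×′ phi q m) (map residues S)
        ≡⟨ parity-↭ _≟²_ lex-tournament
             (λ i j → PermutationOn.injective (permutation-× Φp Φq) (∈-resp-↭ e↭ i) (∈-resp-↭ e↭ j)) e↭ ⟩
      parity lex (phi p m ×′ phi q m) (cartesianProduct X Y)
        ≡⟨ parity-× lex-tournament <-tournament Φp Φq ⟩
      (odd (length Y) ∧ parity _<ᵇ_ (phi p m) X) xor (odd (length X) ∧ parity _<ᵇ_ (phi q m) Y) ∎))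
    where open ≡-Reasoning

-- Modulo a prime 0 is the only nonunit. It is fixed by multiplication, so it flips the parity of
-- the length but leaves that of the permutation: this is the source of the coefficients |A_r| + 1.
Zpow-∷ : ∀ {p} → Prime p → ∀ j → Zpow p j ↭ 0 ∷ ZpowUnits p j
Zpow-∷ {p} pp j = set⇒↭ (Zpow-unique p j) (All.tabulate 0≢ ∷ units-unique p j) to from
  where
  instance _ = prime⇒nonZero pp
  0≢ : ∀ {x} → x ∈ ZpowUnits p j → 0 ≢ x
  0≢ i refl = nonTrivial⇒¬coprime-0 (prime>1 pp) (proj₁ (proj₂ (∈-units⁻ j p i)))
  to : ∀ {x} → x ∈ Zpow p j → x ∈ 0 ∷ ZpowUnits p j
  to {zero}  i = here refl
  to {suc x} i = let x<p , w = ∈-Zpow⁻ j p i in there (∈-units⁺ j p x<p (<-prime-coprime pp (λ ()) x<p) w)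
  0^ : ∀ e → 0 < e → 0 ^ e ≡ 0
  0^ (suc e) _ = refl
  from : ∀ {x} → x ∈ 0 ∷ ZpowUnits p j → x ∈ Zpow p j
  from (here refl) = ∈-Zpow⁺ j p (<-trans 0<1+n (prime>1 pp)) (0 , cong (λ z → modN z p) (0^ (2 ^ j) (m^n>0 2 j)))
  from (there i)   = let x<p , _ , w = ∈-units⁻ j p i in ∈-Zpow⁺ j p x<p w

parity-Zpow : ∀ {p m j} → Prime p → Coprime m p → Power j p m →
  parity _<ᵇ_ (phi p m) (Zpow p j) ≡ parity _<ᵇ_ (phi p m) (ZpowUnits p j)
parity-Zpow {p} {m} {j} pp co pm =
  trans (parity-↭ _≟_ <-tournament (PermutationOn.injective (phi-Zpow co j pm)) (Zpow-∷ pp j))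
    (parity-++ _<ᵇ_ (phi p m) (0 ∷ []) (ZpowUnits p j)
      (↭-reflexive (cong (_∷ []) (trans (cong (λ z → modN z p) (*-zeroʳ m)) (modN-small (<-trans 0<1+n (prime>1 pp))))))
      (permutation-↭ _≟_ (phi-units co j pm)))
  where instance _ = prime⇒nonZero pp

-- In the next two lemmas d says that m is a nonsquare among the 2^(k-1)-th powers
-- modulo p, e that -1 is such a power; d′ and e′ say the same modulo q.
xor-equal : ∀ d d′ e e′ → (d ≡ true → e ≡ true) → (d′ ≡ true → e′ ≡ true) → e ≡ e′ →
  (e′ ∧ d) xor (e ∧ d′) ≡ d xor d′
xor-equal d     d′    true  .true  h h′ refl = refl
xor-equal false false false .false h h′ refl = refl
xor-equal true  d′    false .false h h′ refl with () ← h refl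
xor-equal false true  false .false h h′ refl with () ← h′ refl

xor-unequal : ∀ d d′ e e′ → (d ≡ true → e ≡ true) → (d′ ≡ true → e′ ≡ true) → ¬ (e ≡ true × e′ ≡ true) →
  (not e′ ∧ d) xor (not e ∧ d′) ≡ d xor d′
xor-unequal d     d′    true  true  h h′ n = ⊥-elim (n (refl , refl))
xor-unequal d     false true  false h h′ n = refl
xor-unequal d     true  true  false h h′ n with () ← h′ refl
xor-unequal false d′    false true  h h′ n = refl
xor-unequal true  d′    false true  h h′ n with () ← h refl
xor-unequal d     d′    false false h h′ n = refl

-- Power symbols, conditions modulo 2^k and the conclusion

module _ {p : ℕ} (pp : Prime p) (2<p : 2 < p) where

  private instance _ = prime⇒nonZero pp

  open OddPrime pp 2<p

  power-[-1]⇒≈1 : ∀ j → Power j p (p ∸ 1) → p ≈ 1 [ 2 ^ suc j ]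
  power-[-1]⇒≈1 j w = trans (cong (λ z → modN z (2 ^ suc j)) (sym (suc-pred p))) (∣⇒≈ (2 ^ suc j) 1 (power-[-1]⇒∣ j w))

  ≈1⇒power-[-1] : ∀ j → p ≈ 1 [ 2 ^ suc j ] → Power j p (p ∸ 1)
  ≈1⇒power-[-1] j e = ∣⇒power-[-1] j (≈⇒∣ (2 ^ suc j) 1 (trans (cong (λ z → modN z (2 ^ suc j)) (suc-pred p)) e))

powSym-sign : ∀ k p m .{{_ : NonZero p}} → powSym k p m ≡ sign (not (does (power? k p m)))
powSym-sign k p m with does (isPow2kRes? k p m)
... | true  = refl
... | false = refl

powSym≡1⇒power : ∀ k p m .{{_ : NonZero p}} → powSym k p m ≡ 1ℤ → Power k p m
powSym≡1⇒power k p m e with power? k p m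
... | yes w = w
... | no  n with () ← trans (sym e) (trans (powSym-sign k p m) (cong (sign ∘ not) (dec-false (power? k p m) n)))

does⇒ : ∀ {P : Set} (d : Dec P) → does d ≡ true → P
does⇒ (yes w) _ = w

odd-prime>2 : ∀ {p} → Prime p → modN p 2 ≡ 1 → 2 < p
odd-prime>2 {zero}              pp ()
odd-prime>2 {suc zero}          pp _ = ⊥-elim (<-irrefl refl (prime>1 pp))
odd-prime>2 {suc (suc zero)}    pp ()
odd-prime>2 {suc (suc (suc p))} pp _ = s≤s (s≤s (s≤s z≤n))

≢⇒coprime : ∀ {p q} → Prime p → Prime q → p ≢ q → Coprime p q
≢⇒coprime {p} {q} pp pq p≢q with <-cmp p q
... | tri< a _ _ = Coprime.sym (prime⇒coprime pq {{prime⇒nonZero pp}} a)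
... | tri≈ _ b _ = ⊥-elim (p≢q b)
... | tri> _ _ c = prime⇒coprime pp {{prime⇒nonZero pq}} c

theorem6 : (k p q m : ℕ) → 1 ≤ k →
    Prime p → Prime q → modN p 2 ≡ 1 → modN q 2 ≡ 1 → p ≢ q →
    Coprime m (p * q) →
    powSym (k ∸ 1) p m ≡ 1ℤ → powSym (k ∸ 1) q m ≡ 1ℤ →
    (modN (p * q) (2 ^ k) ≡ modN 1 (2 ^ k) →
    powSym k p m *ℤ powSym k q m ≡ sgn (phi (p * q) m) (Zpow (p * q) (k ∸ 1)))
    × (¬ (modN (p * q) (2 ^ k) ≡ modN 1 (2 ^ k)) →
    powSym k p m *ℤ powSym k q m ≡ sgn (phi (p * q) m) (ZpowUnits (p * q) (k ∸ 1)))
theorem6 (suc j) p q m _ pp pq p-odd q-odd p≢q co sp sq = whole , units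
  where
  open ≡-Reasoning
  open CRT pp pq (≢⇒coprime pp pq p≢q)
  instance
    p≢0 = prime⇒nonZero pp
    q≢0 = prime⇒nonZero pq
    N≢0 = m*n≢0 p q
  p>2 : 2 < p
  p>2 = odd-prime>2 pp p-odd
  q>2 : 2 < q
  q>2 = odd-prime>2 pq q-odd
  module P = OddPrime pp p>2
  module Q = OddPrime pq q>2
  cp : Coprime m p
  cp = coprime-p co
  cq : Coprime m q
  cq = coprime-q co
  wp : Power j p m
  wp = powSym≡1⇒power j p m sp
  wq : Power j q m
  wq = powSym≡1⇒power j q m sq
  wN : Power j (p * q) m
  wN = power-crt j wp wq
  dp dq ep eq : Bool
  dp = not (does (power? (suc j) p m))
  dq = not (does (power? (suc j) q m))
  ep = does (power? j p (p ∸ 1))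
  eq = does (power? j q (q ∸ 1))
  dp≤ep : dp ≡ true → ep ≡ true
  dp≤ep h = dec-true (power? j p (p ∸ 1)) (P.nonsquare⇒power-[-1] cp wp
    (λ w → case trans (sym h) (cong not (dec-true (power? (suc j) p m) w)) of λ ()))
  dq≤eq : dq ≡ true → eq ≡ true
  dq≤eq h = dec-true (power? j q (q ∸ 1)) (Q.nonsquare⇒power-[-1] cq wq
    (λ w → case trans (sym h) (cong not (dec-true (power? (suc j) q m) w)) of λ ()))
  symbols : powSym (suc j) p m *ℤ powSym (suc j) q m ≡ sign (dp xor dq)
  symbols = trans (cong₂ _*ℤ_ (powSym-sign (suc j) p m) (powSym-sign (suc j) q m)) (sym (sign-xor dp dq))

  ep⇒ : ep ≡ true → p ≈ 1 [ 2 ^ suc j ]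
  ep⇒ h = power-[-1]⇒≈1 pp p>2 j (does⇒ (power? j p (p ∸ 1)) h)
  eq⇒ : eq ≡ true → q ≈ 1 [ 2 ^ suc j ]
  eq⇒ h = power-[-1]⇒≈1 pq q>2 j (does⇒ (power? j q (q ∸ 1)) h)

  whole : p * q ≈ 1 [ 2 ^ suc j ] →
    powSym (suc j) p m *ℤ powSym (suc j) q m ≡ sgn (phi (p * q) m) (Zpow (p * q) j)
  whole N≈1 = begin
    powSym (suc j) p m *ℤ powSym (suc j) q m
      ≡⟨ symbols ⟩
    sign (dp xor dq)
      ≡⟨ cong sign (xor-equal dp dq ep eq dp≤ep dq≤eq ep≡eq) ⟨
    sign ((eq ∧ dp) xor (ep ∧ dq))
      ≡⟨ cong sign (cong₂ _xor_
           (cong₂ _∧_ (odd-Zpow pq (Q.odd-units j)) (trans (parity-Zpow pp cp wp) (P.parity-units <-tournament cp wp)))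
           (cong₂ _∧_ (odd-Zpow pp (P.odd-units j)) (trans (parity-Zpow pq cq wq) (Q.parity-units <-tournament cq wq)))) ⟨
    sign ((odd (length (Zpow q j)) ∧ parity _<ᵇ_ (phi p m) (Zpow p j))
      xor (odd (length (Zpow p j)) ∧ parity _<ᵇ_ (phi q m) (Zpow q j)))
      ≡⟨ sgn-residues {m = m} (AllPairs.filter⁺ (isPow2kRes? j (p * q)) (upTo-sorted (p * q)))
           (λ i → proj₁ (∈-Zpow⁻ j (p * q) i))
           (phi-Zpow co j wN) (phi-Zpow cp j wp) (phi-Zpow cq j wq) (Zpow-residues j) ⟨
    sgn (phi (p * q) m) (Zpow (p * q) j) ∎
    where
    odd-Zpow : ∀ {r b} → Prime r → odd (length (ZpowUnits r j)) ≡ not b → odd (length (Zpow r j)) ≡ b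
    odd-Zpow {b = b} pr h = trans (cong odd (↭-length (Zpow-∷ pr j))) (trans (cong not h) (not-involutive b))
    -- As the product is 1 modulo 2^k, either factor being 1 forces the other to be 1.
    p⇒q : p ≈ 1 [ 2 ^ suc j ] → q ≈ 1 [ 2 ^ suc j ]
    p⇒q p≈1 = trans (cong (λ z → modN z (2 ^ suc j)) (sym (*-identityˡ q)))
      (trans (*-≈ (2 ^ suc j) (sym p≈1) refl) N≈1)
    q⇒p : q ≈ 1 [ 2 ^ suc j ] → p ≈ 1 [ 2 ^ suc j ]
    q⇒p q≈1 = trans (cong (λ z → modN z (2 ^ suc j)) (sym (*-identityʳ p)))
      (trans (*-≈ (2 ^ suc j) {p} refl (sym q≈1)) N≈1)
    ep≡eq : ep ≡ eq
    ep≡eq = does-⇔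
      (mk⇔ (≈1⇒power-[-1] pq q>2 j ∘ p⇒q ∘ power-[-1]⇒≈1 pp p>2 j)
           (≈1⇒power-[-1] pp p>2 j ∘ q⇒p ∘ power-[-1]⇒≈1 pq q>2 j))
      (power? j p (p ∸ 1)) (power? j q (q ∸ 1))

  units : ¬ (p * q ≈ 1 [ 2 ^ suc j ]) →
    powSym (suc j) p m *ℤ powSym (suc j) q m ≡ sgn (phi (p * q) m) (ZpowUnits (p * q) j)
  units N≉1 = begin
    powSym (suc j) p m *ℤ powSym (suc j) q m
      ≡⟨ symbols ⟩
    sign (dp xor dq)
      -- If -1 were a 2^j-th power modulo both primes, both would be 1 modulo 2^k, and so would
      -- their product.
      ≡⟨ cong sign (xor-unequal dp dq ep eq dp≤ep dq≤eq
           (λ (h , h′) → N≉1 (*-≈ (2 ^ suc j) (ep⇒ h) (eq⇒ h′)))) ⟨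
    sign ((not eq ∧ dp) xor (not ep ∧ dq))
      ≡⟨ cong sign (cong₂ _xor_
           (cong₂ _∧_ (Q.odd-units j) (P.parity-units <-tournament cp wp))
           (cong₂ _∧_ (P.odd-units j) (Q.parity-units <-tournament cq wq))) ⟨
    sign ((odd (length (ZpowUnits q j)) ∧ parity _<ᵇ_ (phi p m) (ZpowUnits p j))
      xor (odd (length (ZpowUnits p j)) ∧ parity _<ᵇ_ (phi q m) (ZpowUnits q j)))
      ≡⟨ sgn-residues {m = m} (AllPairs.filter⁺ (λ r → (gcd r (p * q) ≟ 1) ×-dec isPow2kRes? j (p * q) r) (upTo-sorted (p * q)))
           (λ i → proj₁ (∈-units⁻ j (p * q) i))
           (phi-units co j wN) (phi-units cp j wp) (phi-units cq j wq) (units-residues j) ⟨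
    sgn (phi (p * q) m) (ZpowUnits (p * q) j) ∎
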